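{- Let $\mathcal A$ be a finite alphabet, let $G \subset AM(\mathcal A^*)$ be a finite group containing an antimorphism, and let $\mathbf u$ be a uniformly recurrent aperiodic infinite word over $\mathcal A$ whose language $\mathcal L(\mathbf u)$ is invariant under all elements of $G$ (i.e. $\Psi(w)\in\mathcal L(\mathbf u)$ for all $w\in\mathcal L(\mathbf u)$ and $\Psi\in G$) and such that the frequency $\rho(w)$ exists for every factor $w \in \mathcal L(\mathbf u)$. Then there exists $N \in \mathbb N$ such that \[\#\{\rho(e)\mid e \in \mathcal L_{n+1}(\mathbf u)\} \;\leq\; \frac{1}{\#G}\Bigl(4\Delta \mathcal C(n)+\#G- X-Y \Bigr) \quad \text{for all } n \geq N,\] where $X$ is the number of bispecial factors of length $n$ of $\mathbf u$ and $Y$ is the number of bispecial factors of length $n$ of $\mathbf u$ that are $\theta$-palindromes for some antimorphism $\theta \in G$.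
   Context: $AM(\mathcal A^*)$ is the monoid (under composition) of all morphisms and antimorphisms of the free monoid $\mathcal A^*$; a map $\varphi$ is a morphism if $\varphi(vw)=\varphi(v)\varphi(w)$ and an antimorphism if $\varphi(vw)=\varphi(w)\varphi(v)$ for all $v,w\in\mathcal A^*$. For an infinite word $\mathbf u$, $\mathcal L(\mathbf u)$ is the set of its finite factors, $\mathcal L_n(\mathbf u)$ those of length $n$, $\mathcal C(n)=\#\mathcal L_n(\mathbf u)$ is the factor complexity and $\Delta\mathcal C(n)=\mathcal C(n+1)-\mathcal C(n)$. The frequency of a factor $w$ is $\rho(w)=\lim_{|v|\to\infty,\, v\in\mathcal L(\mathbf u)} \frac{\#\{\text{occurrences of } w \text{ in } v\}}{|v|}$ when the limit exists. A factor $w$ is right special if $wa,wb\in\mathcal L(\mathbf u)$ for two distinct letters $a,b$, left special if $aw,bw\in\mathcal L(\mathbf u)$ for two distinct letters $a,b$, and bispecial if it is both. For an antimorphism $\theta$, a word $w$ is a $\theta$-palindrome if $\theta(w)=w$. $\mathbf u$ is uniformly recurrent if for every factor the gaps between successive occurrences are bounded.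
   Formalization: The formal theorem additionally assumes that every letter of the alphabet occurs in u; without this the claim fails, e.g. for the Fibonacci word on {a,b} viewed over {a,b,c,d} with G generated by reversal and the swap of c and d. -}

module Defs where

open import Level using (_⊔_)
open import Data.Nat using (ℕ; NonZero)
import Data.Nat as ℕ
import Data.Nat.Properties as ℕₚ
open import Data.Integer using (+_)
open import Data.Rational using (ℚ; 0ℚ; ½; ∣_∣; _-_; _+_; _*_; -_; _<_; _/_)
import Data.Rational.Properties as ℚₚ
open import Data.Rational.Solver using (module +-*-Solver)
open import Data.Fin using (Fin)
import Data.Fin.Properties as Finₚ
open import Data.List using (List; _∷_; [_]; _++_; length; filter; tails; applyUpTo)
open import Data.List.Relation.Binary.Prefix.Heterogeneous.Properties using (prefix?)
import Data.List.Membership.Setoid as Membership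
import Data.List.Relation.Unary.Unique.Setoid as Uniqueness
open import Data.Product using (∃-syntax; _×_; _,_; proj₁)
open import Data.Sum using (_⊎_)
open import Function using (_∘_; id; _⇔_)
open import Relation.Nullary using (¬_)
open import Relation.Unary using (Pred)
open import Relation.Binary.Bundles using (Setoid)
open import Relation.Binary.PropositionalEquality using (_≡_; _≢_; _≗_; refl; sym; trans; cong; subst; setoid)

-- HasCard S P c says #P = c.  It is a relation because the sets counted here
-- (finite, but not decidable for a general infinite word) have no
-- cardinality function constructively.
HasCard : ∀ {a ℓ p} (S : Setoid a ℓ) → Pred (Setoid.Carrier S) p → ℕ → Set (a ⊔ ℓ ⊔ p)
HasCard S P c = ∃[ xs ] Unique xs × length xs ≡ c × (∀ x → x ∈ xs ⇔ P x)
  where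
  open Membership S using (_∈_)
  open Uniqueness S using (Unique)

-- Real numbers as Cauchy sequences of rationals.
record ℝ : Set where
  field
    seq    : ℕ → ℚ
    cauchy : ∀ ε → 0ℚ < ε → ∃[ K ] (∀ m n → K ℕ.≤ m → K ℕ.≤ n → ∣ seq m - seq n ∣ < ε)

open ℝ public

-- Close ε x y lies between ∣ x - y ∣ < ε and ∣ x - y ∣ ≤ ε; it is only used
-- under a quantification over all ε > 0.
Close : ℚ → ℝ → ℝ → Set
Close ε x y = ∃[ K ] (∀ k → K ℕ.≤ k → ∣ seq x k - seq y k ∣ < ε)

infix 4 _≃_

_≃_ : ℝ → ℝ → Set
x ≃ y = ∀ ε → 0ℚ < ε → Close ε x y

private
  ∣p-p∣≡0 : ∀ p → ∣ p - p ∣ ≡ 0ℚ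
  ∣p-p∣≡0 p = cong ∣_∣ (ℚₚ.+-inverseʳ p)

  ∣p-q∣≡∣q-p∣ : ∀ p q → ∣ p - q ∣ ≡ ∣ q - p ∣
  ∣p-q∣≡∣q-p∣ p q = trans (cong ∣_∣ (flip-sub p q)) (ℚₚ.∣-p∣≡∣p∣ (q - p))
    where
    open +-*-Solver
    flip-sub : ∀ p q → p - q ≡ - (q - p)
    flip-sub = solve 2 (λ p q → p :- q := :- (q :- p)) refl

  0<½ε : ∀ {ε} → 0ℚ < ε → 0ℚ < ½ * ε
  0<½ε 0<ε = ℚₚ.*-monoʳ-<-pos ½ 0<ε

  ½ε+½ε≡ε : ∀ ε → ½ * ε + ½ * ε ≡ ε
  ½ε+½ε≡ε ε = trans (sym (ℚₚ.*-distribʳ-+ ε ½ ½)) (ℚₚ.*-identityˡ ε)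

  triangle : ∀ {ε} p q r → ∣ p - q ∣ < ½ * ε → ∣ q - r ∣ < ½ * ε → ∣ p - r ∣ < ε
  triangle {ε} p q r pq qr = begin-strict
    ∣ p - r ∣                ≡⟨ cong ∣_∣ (split p q r) ⟩
    ∣ (p - q) + (q - r) ∣    ≤⟨ ℚₚ.∣p+q∣≤∣p∣+∣q∣ (p - q) (q - r) ⟩
    ∣ p - q ∣ + ∣ q - r ∣    <⟨ ℚₚ.+-mono-< pq qr ⟩
    ½ * ε + ½ * ε            ≡⟨ ½ε+½ε≡ε ε ⟩
    ε                        ∎
    where
    open ℚₚ.≤-Reasoning
    open +-*-Solver
    split : ∀ p q r → p - r ≡ (p - q) + (q - r)
    split = solve 3 (λ p q r → p :- r := (p :- q) :+ (q :- r)) refl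

≃-refl : ∀ {x} → x ≃ x
≃-refl {x} ε 0<ε = 0 , λ k _ → subst (_< ε) (sym (∣p-p∣≡0 (seq x k))) 0<ε

≃-sym : ∀ {x y} → x ≃ y → y ≃ x
≃-sym {x} {y} x≃y ε 0<ε with x≃y ε 0<ε
... | K , close = K , λ k K≤k → subst (_< ε) (∣p-q∣≡∣q-p∣ (seq x k) (seq y k)) (close k K≤k)

≃-trans : ∀ {x y z} → x ≃ y → y ≃ z → x ≃ z
≃-trans {x} {y} {z} x≃y y≃z ε 0<ε with x≃y (½ * ε) (0<½ε 0<ε) | y≃z (½ * ε) (0<½ε 0<ε)
... | K , xy | L , yz = K ℕ.⊔ L , λ k K⊔L≤k →
  triangle (seq x k) (seq y k) (seq z k)
    (xy k (ℕₚ.≤-trans (ℕₚ.m≤m⊔n K L) K⊔L≤k))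
    (yz k (ℕₚ.≤-trans (ℕₚ.m≤n⊔m K L) K⊔L≤k))

ℝ-setoid : Setoid _ _
ℝ-setoid = record
  { Carrier       = ℝ
  ; _≈_           = _≃_
  ; isEquivalence = record
    { refl  = λ {x} → ≃-refl {x}
    ; sym   = λ {x y} → ≃-sym {x} {y}
    ; trans = λ {x y z} → ≃-trans {x} {y} {z}
    }
  }

fromℚ : ℚ → ℝ
fromℚ q = record
  { seq    = λ _ → q
  ; cauchy = λ ε 0<ε → 0 , λ _ _ _ _ → subst (_< ε) (sym (∣p-p∣≡0 q)) 0<ε
  }

Word : ℕ → Set
Word k = List (Fin k)

InfWord : ℕ → Set
InfWord k = ℕ → Fin k

Word-setoid : ℕ → Setoid _ _
Word-setoid k = setoid (Word k)

Morphism : ∀ {k} → (Word k → Word k) → Set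
Morphism φ = ∀ v w → φ (v ++ w) ≡ φ v ++ φ w

Antimorphism : ∀ {k} → (Word k → Word k) → Set
Antimorphism φ = ∀ v w → φ (v ++ w) ≡ φ w ++ φ v

-- A finite group G ⊂ AM(A*), A = Fin k: its elements are listed without
-- repetition, maps being compared pointwise, so that order = #G.
record FiniteSubgroupAM (k : ℕ) : Set where
  field
    order     : ℕ
    elem      : Fin order → Word k → Word k
    distinct  : ∀ i j → elem i ≗ elem j → i ≡ j
    inAM      : ∀ i → Morphism (elem i) ⊎ Antimorphism (elem i)
    identity  : ∃[ i ] elem i ≗ id
    composite : ∀ i j → ∃[ l ] elem l ≗ elem i ∘ elem j
    inverse   : ∀ i → ∃[ j ] (elem i ∘ elem j ≗ id) × (elem j ∘ elem i ≗ id)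

  instance
    order-nonZero : NonZero order
    order-nonZero = Finₚ.nonZeroIndex (proj₁ identity)

module _ {k : ℕ} (u : InfWord k) where

  OccursAt : Word k → ℕ → Set
  OccursAt w i = applyUpTo (λ j → u (i ℕ.+ j)) (length w) ≡ w

  𝓛 : Word k → Set
  𝓛 w = ∃[ i ] OccursAt w i

  𝓛ₙ : ℕ → Word k → Set
  𝓛ₙ n w = 𝓛 w × length w ≡ n

  UniformlyRecurrent : Set
  UniformlyRecurrent = ∀ w → 𝓛 w →
    ∃[ R ] (∀ i → OccursAt w i → ∃[ j ] i ℕ.< j × j ℕ.≤ i ℕ.+ R × OccursAt w j)

  EventuallyPeriodic : Set
  EventuallyPeriodic = ∃[ p ] ∃[ m ] 0 ℕ.< p × (∀ i → m ℕ.≤ i → u (i ℕ.+ p) ≡ u i)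

  Aperiodic : Set
  Aperiodic = ¬ EventuallyPeriodic

  RightSpecial : Word k → Set
  RightSpecial w = ∃[ a ] ∃[ b ] a ≢ b × 𝓛 (w ++ [ a ]) × 𝓛 (w ++ [ b ])

  LeftSpecial : Word k → Set
  LeftSpecial w = ∃[ a ] ∃[ b ] a ≢ b × 𝓛 (a ∷ w) × 𝓛 (b ∷ w)

  BispecialOfLength : ℕ → Word k → Set
  BispecialOfLength n w = 𝓛ₙ n w × LeftSpecial w × RightSpecial w

  InvariantUnder : FiniteSubgroupAM k → Set
  InvariantUnder G = ∀ i w → 𝓛 w → 𝓛 (elem i w)
    where open FiniteSubgroupAM G

GPalindrome : ∀ {k} → FiniteSubgroupAM k → Word k → Set
GPalindrome G w = ∃[ i ] Antimorphism (elem i) × elem i w ≡ w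
  where open FiniteSubgroupAM G

-- An occurrence of w in v is a suffix of v having w as a prefix.
occurrences : ∀ {k} → Word k → Word k → ℕ
occurrences w v = length (filter (prefix? Finₚ._≟_ w) (tails v))

-- ρ is the limit of occurrences w v / ∣v∣ as ∣v∣ → ∞ over all factors v of u
-- (not only over prefixes of u).
IsFrequency : ∀ {k} → InfWord k → Word k → ℝ → Set
IsFrequency u w ρ = ∀ ε → 0ℚ < ε →
  ∃[ M ] (∀ v → .{{_ : NonZero (length v)}} → 𝓛 u v → M ℕ.≤ length v →
    Close ε (fromℚ (+ occurrences w v / length v)) ρ)

-- The set { ρ(e) ∣ e ∈ 𝓛ₙ(u) } of reals.
Frequencies : ∀ {k} → InfWord k → ℕ → ℝ → Set
Frequencies u n ρ = ∃[ e ] 𝓛ₙ u n e × IsFrequency u e ρ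

{-# OPTIONS --safe #-}
-- In the Rauzy graph of order n (vertices 𝓛ₙ, arrows 𝓛ₙ₊₁) contract every path
-- through non-special factors to a single edge.  By Kirchhoff's law all arrows of
-- such a reduced edge have the same frequency, and frequencies are G-invariant, so
-- there are at most as many frequencies as G-orbits of reduced edges.
--
-- For large n every factor of length n contains all letters, so G acts on factors
-- and reduced edges with stabilisers of order at most 2, and the stabiliser has
-- order 2 exactly for the palindromic ones.  Let V, E and P count the special
-- factors, the reduced edges and the palindromic reduced edges.  Then #G times the
-- number of orbits is E + P for edges and V + Y for vertices (a special palindrome
-- is bispecial).  The graph of orbits is connected and palindromic edges are loops
-- in it, so a spanning tree gives V + Y ≤ #G + (E - P).  With E = V + ΔC and
-- V + X = #right special + #left special ≤ 2ΔC, this yields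
-- E + P ≤ 2E - V + #G - Y = 2ΔC + V + #G - Y ≤ 4ΔC + #G - X - Y.
module Submission where

open import Defs

-- Orbits are never formed. Every estimate is an injection between finite lists in which the
-- palindromes in question are listed a second time. At most two elements of `G` carry a given long
-- word to the same image, and `Least` and `NonLeast` match these elements with the two copies, so a
-- factor #G times a number of orbits appears as a set of pairs of a group element and a
-- representative.
--
-- The word `u` supplies the graph. A reduced edge is read off between two consecutive special
-- positions of `u`, and aperiodicity provides such positions arbitrarily far out. Connectedness
-- needs no separate argument, because `u` walks through the graph: only the orbit of its first
-- special factor is reached without traversing a reduced edge, and the `order` images of this root
-- make up the summand #G.
--
-- Membership in `𝓛` is undecidable in general, as is equality of reals. The given lists of factors
-- decide membership at lengths `n` and `suc n`, which is all that is asked, and frequencies are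
-- told apart by their indices.

module Counting where
  open import Level using (Level)
  open import Data.Nat using (ℕ; zero; suc; _+_; _≤_; _<_; s≤s)
  open import Data.Nat.Properties using (+-suc; +-identityʳ; <-irrefl; <-≤-trans; n<1+n; m<n⇒m<1+n; m<1+n⇒m<n∨m≡n; m<1+n⇒m≤n)
  open import Data.Fin using (Fin; zero; suc)
  import Data.Fin as Fin
  import Data.Fin.Properties as Finₚ
  open import Data.List using (List; []; _∷_; _++_; map; length; lookup; filter)
  open import Data.List.Properties using (length-++; length-map)
  open import Data.List.Membership.Propositional using (_∈_)
  open import Data.List.Membership.Propositional.Properties using (∈-lookup; ∈-++⁺ˡ; ∈-++⁺ʳ; ∈-++⁻; ∈-map⁺; ∈-map⁻)
  open import Data.List.Relation.Unary.All as All using ([]; _∷_)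
  open import Data.List.Relation.Unary.AllPairs using (AllPairs; []; _∷_)
  import Data.List.Relation.Unary.Any as Any
  open import Data.List.Relation.Unary.Any.Properties using (lookup-index)
  open import Data.List.Relation.Unary.Unique.Propositional using (Unique)
  import Data.List.Relation.Unary.Unique.Propositional.Properties as Uniqueₚ
  open import Data.Product using (∃-syntax; _×_; _,_; proj₁; proj₂)
  open import Data.Sum using (_⊎_; inj₁; inj₂)
  open import Data.Sum.Properties using (inj₁-injective; inj₂-injective)
  open import Data.Empty using (⊥-elim)
  open import Function using (_∘_)
  open import Relation.Binary using (Rel; Symmetric; tri<; tri≈; tri>)
  open import Relation.Binary.PropositionalEquality using (_≡_; _≢_; refl; sym; trans; cong; cong₂; subst)
  open import Relation.Nullary using (¬_; yes; no)
  open import Relation.Unary using (Pred; Decidable)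
  open import Relation.Unary.Properties using (∁?)

  private
    variable
      a b r : Level
      A : Set a
      B : Set b

  lookup-pairwise : {R : Rel A r} → Symmetric R → ∀ {xs} → AllPairs R xs →
    ∀ i j → i ≢ j → R (lookup xs i) (lookup xs j)
  lookup-pairwise sy (x ∷ xs) zero    zero    i≢j = ⊥-elim (i≢j refl)
  lookup-pairwise sy (x ∷ xs) zero    (suc j) i≢j = All.lookup x (∈-lookup j)
  lookup-pairwise sy (x ∷ xs) (suc i) zero    i≢j = sy (All.lookup x (∈-lookup i))
  lookup-pairwise sy (x ∷ xs) (suc i) (suc j) i≢j = lookup-pairwise sy xs i j (i≢j ∘ cong suc)

  -- Pigeonhole for a relation instead of a function. The image may be chosen from the proof of
  -- `x ∈ xs`, and injectivity is asked of the whole relation, so that the choice does not matter.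
  -- All counting inequalities below are instances.
  length-≤ : {xs : List A} {ys : List B} (R : A → B → Set r) → Unique xs →
    (∀ {x} → x ∈ xs → ∃[ y ] y ∈ ys × R x y) →
    (∀ {x x′ y} → R x y → R x′ y → x ≡ x′) →
    length xs ≤ length ys
  length-≤ {xs = xs} {ys} R unique total injective = Finₚ.injective⇒≤ {f = f} f-injective
    where
    image : ∀ i → ∃[ y ] y ∈ ys × R (lookup xs i) y
    image i = total (∈-lookup i)

    f : Fin (length xs) → Fin (length ys)
    f i = Any.index (proj₁ (proj₂ (image i)))

    R-f : ∀ i → R (lookup xs i) (lookup ys (f i))
    R-f i = subst (R (lookup xs i)) (lookup-index (proj₁ (proj₂ (image i)))) (proj₂ (proj₂ (image i)))

    f-injective : ∀ {i j} → f i ≡ f j → i ≡ j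
    f-injective {i} {j} fi≡fj with i Finₚ.≟ j
    ... | yes i≡j = i≡j
    ... | no  i≢j = ⊥-elim (lookup-pairwise (λ p q → p (sym q)) unique i j i≢j
                      (injective (R-f i) (subst (λ z → R (lookup xs j) (lookup ys z)) (sym fi≡fj) (R-f j))))

  -- Disjoint unions of lists, for sums of cardinalities

  infixr 5 _⊕_

  _⊕_ : List A → List B → List (A ⊎ B)
  xs ⊕ ys = map inj₁ xs ++ map inj₂ ys

  length-⊕ : (xs : List A) (ys : List B) → length (xs ⊕ ys) ≡ length xs + length ys
  length-⊕ xs ys = trans (length-++ (map inj₁ xs)) (cong₂ _+_ (length-map inj₁ xs) (length-map inj₂ ys))

  ∈-⊕ˡ : {xs : List A} {ys : List B} {x : A} → x ∈ xs → inj₁ x ∈ xs ⊕ ys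
  ∈-⊕ˡ = ∈-++⁺ˡ ∘ ∈-map⁺ inj₁

  ∈-⊕ʳ : (xs : List A) {ys : List B} {y : B} → y ∈ ys → inj₂ y ∈ xs ⊕ ys
  ∈-⊕ʳ xs = ∈-++⁺ʳ (map inj₁ xs) ∘ ∈-map⁺ inj₂

  ∈-⊕⁻ : (xs : List A) {ys : List B} {z : A ⊎ B} → z ∈ xs ⊕ ys →
    (∃[ x ] x ∈ xs × z ≡ inj₁ x) ⊎ (∃[ y ] y ∈ ys × z ≡ inj₂ y)
  ∈-⊕⁻ xs z∈ with ∈-++⁻ (map inj₁ xs) z∈
  ... | inj₁ p = inj₁ (∈-map⁻ inj₁ p)
  ... | inj₂ q = inj₂ (∈-map⁻ inj₂ q)

  ⊕-unique : {xs : List A} {ys : List B} → Unique xs → Unique ys → Unique (xs ⊕ ys)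
  ⊕-unique {xs = xs} {ys} u v = Uniqueₚ.++⁺ (Uniqueₚ.map⁺ inj₁-injective u) (Uniqueₚ.map⁺ inj₂-injective v) disjoint
    where
    disjoint : ∀ {z} → ¬ (z ∈ map inj₁ xs × z ∈ map inj₂ ys)
    disjoint (p , q) with ∈-map⁻ inj₁ p | ∈-map⁻ inj₂ q
    ... | _ , _ , refl | _ , _ , ()

  length-filter-∁ : ∀ {p} {P : Pred A p} (P? : Decidable P) xs →
    length (filter P? xs) + length (filter (∁? P?) xs) ≡ length xs
  length-filter-∁ P? []       = refl
  length-filter-∁ P? (x ∷ xs) with P? x
  ... | yes _ = cong suc (length-filter-∁ P? xs)
  ... | no  _ = trans (+-suc _ _) (cong suc (length-filter-∁ P? xs))

  -- If `P` holds for one or two indices, `Least` selects the smaller, and a `NonLeast` index exists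
  -- exactly when there are two. This separates the two group elements with a common image, and also
  -- a first from a second one-letter extension of a factor.
  Least : ∀ {m p} → Pred (Fin m) p → Pred (Fin m) p
  Least P i = P i × (∀ j → j Fin.< i → ¬ P j)

  NonLeast : ∀ {m p} → Pred (Fin m) p → Pred (Fin m) p
  NonLeast P i = P i × ∃[ j ] j Fin.< i × P j

  least : ∀ {m p} {P : Pred (Fin m) p} → Decidable P → ∀ {i} → P i → ∃[ l ] Least P l
  least {suc m} P? {i} pi with P? zero
  ... | yes p₀ = zero , p₀ , λ _ ()
  least {suc m} P? {zero}  pi | no ¬p₀ = ⊥-elim (¬p₀ pi)
  least {suc m} P? {suc i} pi | no ¬p₀ with least (P? ∘ suc) pi
  ... | l , pl , min = suc l , pl , λ { zero _ → ¬p₀ ; (suc j) (s≤s j<l) → min j j<l }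

  Least-unique : ∀ {m p} {P : Pred (Fin m) p} {i j} → Least P i → Least P j → i ≡ j
  Least-unique {i = i} {j} (pi , mi) (pj , mj) with Finₚ.<-cmp i j
  ... | tri< i<j _ _ = ⊥-elim (mj i i<j pi)
  ... | tri≈ _ i≡j _ = i≡j
  ... | tri> _ _ j<i = ⊥-elim (mi j j<i pj)

  nonLeast : ∀ {m p} {P : Pred (Fin m) p} {i j} → i ≢ j → P i → P j → ∃[ l ] NonLeast P l
  nonLeast {i = i} {j} i≢j pi pj with Finₚ.<-cmp i j
  ... | tri< i<j _ _ = j , pj , i , i<j , pi
  ... | tri≈ _ i≡j _ = ⊥-elim (i≢j i≡j)
  ... | tri> _ _ j<i = i , pi , j , j<i , pj

  ¬Least×NonLeast : ∀ {m p} {P : Pred (Fin m) p} {i} → Least P i → ¬ NonLeast P i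
  ¬Least×NonLeast (_ , min) (_ , j , j<i , pj) = min j j<i pj

  module _ {p} {P : Pred ℕ p} (P? : Decidable P) where

    leastℕ : ∀ m → (∃[ l ] l < m × P l × (∀ j → j < l → ¬ P j)) ⊎ (∀ j → j < m → ¬ P j)
    leastℕ zero = inj₂ λ _ ()
    leastℕ (suc m) with leastℕ m
    ... | inj₁ (l , l<m , pl , min) = inj₁ (l , m<n⇒m<1+n l<m , pl , min)
    ... | inj₂ none with P? m
    ...   | yes pm = inj₁ (m , n<1+n m , pm , none)
    ...   | no ¬pm = inj₂ λ j j<1+m → below j (m<1+n⇒m<n∨m≡n j<1+m)
      where
      below : ∀ j → j < m ⊎ j ≡ m → ¬ P j
      below j (inj₁ j<m) = none j j<m
      below j (inj₂ refl) = ¬pm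

    -- The distance from `l` to `m` is returned as `suc d` because it serves as the length of a step
    -- in the reduced graph, with `d` positions strictly in between.
    greatestBelow : ∀ m → (∃[ l ] ∃[ d ] l + suc d ≡ m × P l × (∀ j → l < j → j < m → ¬ P j)) ⊎ (∀ j → j < m → ¬ P j)
    greatestBelow zero = inj₂ λ _ ()
    greatestBelow (suc m) with P? m
    ... | yes pm = inj₁ (m , 0 , trans (+-suc m 0) (cong suc (+-identityʳ m)) , pm ,
                         λ j m<j j<1+m → ⊥-elim (<-irrefl refl (<-≤-trans m<j (m<1+n⇒m≤n j<1+m))))
    ... | no ¬pm with greatestBelow m
    ...   | inj₂ none = inj₂ λ j j<1+m → below j (m<1+n⇒m<n∨m≡n j<1+m)
      where
      below : ∀ j → j < m ⊎ j ≡ m → ¬ P j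
      below j (inj₁ j<m) = none j j<m
      below j (inj₂ refl) = ¬pm
    ...   | inj₁ (l , d , eq , pl , max) = inj₁ (l , suc d , trans (+-suc l (suc d)) (cong suc eq) , pl ,
        λ j l<j j<1+m → below j l<j (m<1+n⇒m<n∨m≡n j<1+m))
      where
      below : ∀ j → l < j → j < m ⊎ j ≡ m → ¬ P j
      below j l<j (inj₁ j<m) = max j l<j j<m
      below j l<j (inj₂ refl) = ¬pm

-- Factors of the infinite word and the action of the group on words

module Words where
  open import Data.Nat using (ℕ; zero; suc; _+_; _≤_; z≤n; s≤s)
  open import Data.Nat.Properties hiding (_≟_)
  open import Data.Fin using (Fin; zero; suc)
  open import Data.List using (List; []; _∷_; [_]; _++_; length; applyUpTo)
  open import Data.List.Properties using (length-++; length-applyUpTo; ++-assoc; ∷-injective; ∷-injectiveˡ; applyUpTo-∷ʳ)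
  open import Data.Product using (∃-syntax; _×_; _,_; proj₁; proj₂)
  open import Data.Sum using (_⊎_; inj₁; inj₂)
  open import Data.Empty using (⊥-elim)
  open import Function using (_∘_)
  open import Relation.Binary.PropositionalEquality hiding ([_])
  open import Relation.Nullary using (¬_)

  ++-split : ∀ {a} {A : Set a} (xs xs′ : List A) {ys ys′ : List A} →
    length xs ≡ length xs′ → xs ++ ys ≡ xs′ ++ ys′ → xs ≡ xs′ × ys ≡ ys′
  ++-split []       []        _  eq = refl , eq
  ++-split (x ∷ xs) (y ∷ xs′) le eq with ∷-injective eq
  ... | refl , eq′ with ++-split xs xs′ (suc-injective le) eq′
  ...   | refl , eq″ = refl , eq″

  length-1 : ∀ {a} {A : Set a} (xs : List A) → length xs ≡ 1 → ∃[ x ] xs ≡ [ x ]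
  length-1 (x ∷ []) refl = x , refl

  applyUpTo-cong : ∀ {a} {A : Set a} {f g : ℕ → A} → f ≗ g → applyUpTo f ≗ applyUpTo g
  applyUpTo-cong f≗g zero    = refl
  applyUpTo-cong f≗g (suc m) = cong₂ _∷_ (f≗g 0) (applyUpTo-cong (f≗g ∘ suc) m)

  applyUpTo-+ : ∀ {a} {A : Set a} (f : ℕ → A) m l →
    applyUpTo f (m + l) ≡ applyUpTo f m ++ applyUpTo (λ j → f (m + j)) l
  applyUpTo-+ f zero    l = refl
  applyUpTo-+ f (suc m) l = cong (f 0 ∷_) (applyUpTo-+ (f ∘ suc) m l)

  module _ {k : ℕ} (u : InfWord k) where

    -- With this notation `OccursAt u w i` unfolds to `factor i (length w) ≡ w`, so a proof of an
    -- occurrence is used directly as an equation between factors.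
    factor : ℕ → ℕ → Word k
    factor i m = applyUpTo (λ j → u (i + j)) m

    length-factor : ∀ i m → length (factor i m) ≡ m
    length-factor i = length-applyUpTo _

    factor∈𝓛 : ∀ i m → 𝓛 u (factor i m)
    factor∈𝓛 i m = i , cong (factor i) (length-factor i m)

    factor-+ : ∀ i m l → factor i (m + l) ≡ factor i m ++ factor (i + m) l
    factor-+ i m l = trans (applyUpTo-+ _ m l)
      (cong (factor i m ++_) (applyUpTo-cong (λ j → cong u (sym (+-assoc i m j))) l))

    factor-snoc : ∀ i m → factor i (suc m) ≡ factor i m ++ [ u (i + m) ]
    factor-snoc i m = sym (applyUpTo-∷ʳ _ m)

    factor-cons : ∀ i m → factor i (suc m) ≡ u i ∷ factor (suc i) m
    factor-cons i m = cong₂ _∷_ (cong u (+-identityʳ i)) (applyUpTo-cong (λ j → cong u (+-suc i j)) m)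

    𝓛⇒factor : ∀ {w} → 𝓛 u w → ∃[ i ] w ≡ factor i (length w)
    𝓛⇒factor (i , occ) = i , sym occ

    𝓛-++ : ∀ x y → 𝓛 u (x ++ y) → 𝓛 u x × 𝓛 u y
    𝓛-++ x y (i , occ) = (i , proj₁ both) , (i + length x , proj₂ both)
      where
      both = ++-split (factor i (length x)) x (length-factor i (length x))
        (trans (sym (factor-+ i (length x) (length y))) (trans (cong (factor i) (sym (length-++ x))) occ))

    factor-middle : ∀ {i t} a {m b} → t ≡ a + (m + b) → ∀ x y {z} →
      length x ≡ a → length y ≡ m → factor i t ≡ x ++ y ++ z → y ≡ factor (i + a) m
    factor-middle {i} a {m} {b} refl x y lx ly eq = sym (proj₁ inner)
      where
      outer = ++-split (factor i a) x (trans (length-factor i a) (sym lx)) (trans (sym (factor-+ i a (m + b))) eq)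
      inner = ++-split (factor (i + a) m) y (trans (length-factor (i + a) m) (sym ly))
        (trans (sym (factor-+ (i + a) m b)) (proj₂ outer))

    factor-split₃ : ∀ i a m b → factor i (a + (m + b)) ≡ factor i a ++ factor (i + a) m ++ factor (i + a + m) b
    factor-split₃ i a m b = trans (factor-+ i a (m + b)) (cong (factor i a ++_) (factor-+ (i + a) m b))

    Special : Word k → Set
    Special w = LeftSpecial u w ⊎ RightSpecial u w

  -- The condition under which the stabilisers become small: the image of such a word reveals the
  -- image of every letter, once the kind of the map is known.
  AllLetters : ∀ {k} → Word k → Set
  AllLetters {k} w = ∀ a → ∃[ x ] ∃[ z ] w ≡ x ++ [ a ] ++ z

  AllLetters-++ : ∀ {k} (x y z : Word k) → AllLetters y → AllLetters (x ++ y ++ z)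
  AllLetters-++ x y z all a with all a
  ... | p , q , refl = x ++ p , q ++ z , (begin
    x ++ (p ++ a ∷ q) ++ z   ≡⟨ cong (x ++_) (++-assoc p (a ∷ q) z) ⟩
    x ++ p ++ a ∷ q ++ z     ≡⟨ ++-assoc x p (a ∷ q ++ z) ⟨
    (x ++ p) ++ a ∷ q ++ z   ∎)
    where open ≡-Reasoning

  SameKind OppositeKind : ∀ {k} (φ ψ : Word k → Word k) → Set
  SameKind     φ ψ = Morphism φ × Morphism ψ ⊎ Antimorphism φ × Antimorphism ψ
  OppositeKind φ ψ = Morphism φ × Antimorphism ψ ⊎ Antimorphism φ × Morphism ψ

  anti₃ : ∀ {k} (φ : Word k → Word k) → Antimorphism φ → ∀ x y z → φ (x ++ y ++ z) ≡ φ z ++ φ y ++ φ x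
  anti₃ φ anti x y z = begin
    φ (x ++ y ++ z)       ≡⟨ anti x (y ++ z) ⟩
    φ (y ++ z) ++ φ x     ≡⟨ cong (_++ φ x) (anti y z) ⟩
    (φ z ++ φ y) ++ φ x   ≡⟨ ++-assoc (φ z) (φ y) (φ x) ⟩
    φ z ++ φ y ++ φ x     ∎
    where open ≡-Reasoning

  morph₃ : ∀ {k} (φ : Word k → Word k) → Morphism φ → ∀ x y z → φ (x ++ y ++ z) ≡ φ x ++ φ y ++ φ z
  morph₃ φ morph x y z = trans (morph x (y ++ z)) (cong (φ x ++_) (morph y z))

  module GroupAction {k : ℕ} (G : FiniteSubgroupAM k) where
    open FiniteSubgroupAM G

    private
      image-[] : ∀ g → elem g [] ≡ []
      image-[] g = go (elem g []) (square (inAM g))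
        where
        square : Morphism (elem g) ⊎ Antimorphism (elem g) → elem g [] ≡ elem g [] ++ elem g []
        square (inj₁ m) = m [] []
        square (inj₂ m) = m [] []
        go : (x : Word k) → x ≡ x ++ x → x ≡ []
        go []       _  = refl
        go x@(_ ∷ xs) eq = ⊥-elim (m≢1+m+n (length x) (trans (cong length eq)
          (trans (length-++ x) (+-suc (length x) (length xs)))))

    elem-injective : ∀ g {v w} → elem g v ≡ elem g w → v ≡ w
    elem-injective g {v} {w} eq with inverse g
    ... | h , _ , left = trans (sym (left v)) (trans (cong (elem h) eq) (left w))

    private
      -- The empty word is its own image, so an injective map sends no letter to it. Applied to an
      -- element and to its inverse, this shows that the group preserves lengths.
      length-image-≥ : ∀ g w → length w ≤ length (elem g w)
      length-image-≥ g []      = z≤n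
      length-image-≥ g (a ∷ w) = begin
        suc (length w)                                ≤⟨ +-mono-≤ (letter (elem g [ a ]) refl) (length-image-≥ g w) ⟩
        length (elem g [ a ]) + length (elem g w)     ≡⟨ split (inAM g) ⟨
        length (elem g (a ∷ w))                       ∎
        where
        open ≤-Reasoning
        letter : ∀ x → elem g [ a ] ≡ x → 1 ≤ length x
        letter []      eq with elem-injective g (trans eq (sym (image-[] g)))
        ... | ()
        letter (_ ∷ _) eq = s≤s z≤n
        split : Morphism (elem g) ⊎ Antimorphism (elem g) →
          length (elem g (a ∷ w)) ≡ length (elem g [ a ]) + length (elem g w)
        split (inj₁ m) = trans (cong length (m [ a ] w)) (length-++ (elem g [ a ]))
        split (inj₂ m) = trans (cong length (m [ a ] w)) (trans (length-++ (elem g w)) (+-comm (length (elem g w)) _))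

    length-elem : ∀ g w → length (elem g w) ≡ length w
    length-elem g w with inverse g
    ... | h , _ , left = ≤-antisym
      (subst (λ x → length (elem g w) ≤ length x) (left w) (length-image-≥ h (elem g w)))
      (length-image-≥ g w)

    kind-cmp : ∀ g h → SameKind (elem g) (elem h) ⊎ OppositeKind (elem g) (elem h)
    kind-cmp g h with inAM g | inAM h
    ... | inj₁ p | inj₁ q = inj₁ (inj₁ (p , q))
    ... | inj₁ p | inj₂ q = inj₂ (inj₁ (p , q))
    ... | inj₂ p | inj₁ q = inj₂ (inj₂ (p , q))
    ... | inj₂ p | inj₂ q = inj₁ (inj₂ (p , q))

    private
      letters-determine : ∀ g h → SameKind (elem g) (elem h) → (∀ a → elem g [ a ] ≡ elem h [ a ]) → elem g ≗ elem h
      letters-determine g h kind eq []      = trans (image-[] g) (sym (image-[] h))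
      letters-determine g h kind@(inj₁ (p , q)) eq (a ∷ w) =
        trans (p [ a ] w) (trans (cong₂ _++_ (eq a) (letters-determine g h kind eq w)) (sym (q [ a ] w)))
      letters-determine g h kind@(inj₂ (p , q)) eq (a ∷ w) =
        trans (p [ a ] w) (trans (cong₂ _++_ (letters-determine g h kind eq w) (eq a)) (sym (q [ a ] w)))

    -- Maps of the same kind that preserve lengths put the image of a given letter of `w` at the
    -- same place. Equal images of `w` therefore force equal images of all letters, hence equal
    -- maps.
    same-kind-≡ : ∀ {w} → AllLetters w → ∀ g h → SameKind (elem g) (elem h) → elem g w ≡ elem h w → g ≡ h
    same-kind-≡ {w} all g h kind eq = distinct g h (letters-determine g h kind (letter kind))
      where
      same-length : ∀ x → length (elem g x) ≡ length (elem h x)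
      same-length x = trans (length-elem g x) (sym (length-elem h x))

      first : ∀ x y z {v} → elem g x ++ elem g y ++ z ≡ elem h x ++ elem h y ++ v → elem g y ≡ elem h y
      first x y z e = proj₁ (++-split (elem g y) (elem h y) (same-length y)
        (proj₂ (++-split (elem g x) (elem h x) (same-length x) e)))

      letter : SameKind (elem g) (elem h) → ∀ a → elem g [ a ] ≡ elem h [ a ]
      letter kind a with all a
      letter (inj₁ (p , q)) a | x , z , refl =
        first x [ a ] _ (trans (sym (morph₃ (elem g) p x [ a ] z)) (trans eq (morph₃ (elem h) q x [ a ] z)))
      letter (inj₂ (p , q)) a | x , z , refl =
        first z [ a ] _ (trans (sym (anti₃ (elem g) p x [ a ] z)) (trans eq (anti₃ (elem h) q x [ a ] z)))

    ≢⇒opposite : ∀ {w} → AllLetters w → ∀ {g h} → g ≢ h → elem g w ≡ elem h w → OppositeKind (elem g) (elem h)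
    ≢⇒opposite all {g} {h} g≢h eq with kind-cmp g h
    ... | inj₁ same = ⊥-elim (g≢h (same-kind-≡ all g h same eq))
    ... | inj₂ opp  = opp

    inverse-morphism : ∀ g → Morphism (elem g) → Morphism (elem (proj₁ (inverse g)))
    inverse-morphism g m v w with inverse g
    ... | h , right , left = begin
      elem h (v ++ w)                                ≡⟨ cong (elem h) (cong₂ _++_ (right v) (right w)) ⟨
      elem h (elem g (elem h v) ++ elem g (elem h w)) ≡⟨ cong (elem h) (m (elem h v) (elem h w)) ⟨
      elem h (elem g (elem h v ++ elem h w))         ≡⟨ left _ ⟩
      elem h v ++ elem h w                           ∎
      where open ≡-Reasoning

    private
      -- The witness is `g` composed with the inverse of `h`: an antimorphism that sends `elem h w`,
      -- which is `elem g w`, to `elem g w`.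
      quotient-fixes : ∀ {w g h} → Antimorphism (elem g) → Morphism (elem h) → elem g w ≡ elem h w →
        GPalindrome G (elem g w)
      quotient-fixes {w} {g} {h} anti morph eq = l , anti-l , fix
        where
        h⁻¹ = proj₁ (inverse h)
        l = proj₁ (composite g h⁻¹)
        l≗ = proj₂ (composite g h⁻¹)
        open ≡-Reasoning
        anti-l : Antimorphism (elem l)
        anti-l x y = begin
          elem l (x ++ y)                        ≡⟨ l≗ (x ++ y) ⟩
          elem g (elem h⁻¹ (x ++ y))             ≡⟨ cong (elem g) (inverse-morphism h morph x y) ⟩
          elem g (elem h⁻¹ x ++ elem h⁻¹ y)      ≡⟨ anti _ _ ⟩
          elem g (elem h⁻¹ y) ++ elem g (elem h⁻¹ x) ≡⟨ cong₂ _++_ (l≗ y) (l≗ x) ⟨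
          elem l y ++ elem l x                   ∎
        fix : elem l (elem g w) ≡ elem g w
        fix = begin
          elem l (elem g w)            ≡⟨ l≗ _ ⟩
          elem g (elem h⁻¹ (elem g w)) ≡⟨ cong (elem g ∘ elem h⁻¹) eq ⟩
          elem g (elem h⁻¹ (elem h w)) ≡⟨ cong (elem g) (proj₂ (proj₂ (inverse h)) w) ⟩
          elem g w                     ∎

    stabilised⇒palindrome : ∀ {w} → AllLetters w → ∀ {g h} → g ≢ h → elem g w ≡ elem h w → GPalindrome G (elem g w)
    stabilised⇒palindrome all g≢h eq with ≢⇒opposite all g≢h eq
    ... | inj₁ (m , a) = subst (GPalindrome G) (sym eq) (quotient-fixes a m (sym eq))
    ... | inj₂ (a , m) = quotient-fixes a m eq

    -- There are only two kinds. As `f`, `g` and as `g`, `h` must differ in kind, `f` and `h` have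
    -- the same kind and agree on `w`.
    at-most-two : ∀ {w} → AllLetters w → ∀ {f g h} → f ≢ g → g ≢ h →
      elem f w ≡ elem g w → elem g w ≡ elem h w → f ≡ h
    at-most-two all {f} {g} {h} f≢g g≢h eq eq′ = cases (inAM f) (inAM g) (inAM h)
      where
      cases : Morphism (elem f) ⊎ Antimorphism (elem f) → Morphism (elem g) ⊎ Antimorphism (elem g) →
        Morphism (elem h) ⊎ Antimorphism (elem h) → f ≡ h
      cases (inj₁ p) _        (inj₁ r) = same-kind-≡ all f h (inj₁ (p , r)) (trans eq eq′)
      cases (inj₂ p) _        (inj₂ r) = same-kind-≡ all f h (inj₂ (p , r)) (trans eq eq′)
      cases (inj₁ p) (inj₁ q) (inj₂ _) = ⊥-elim (f≢g (same-kind-≡ all f g (inj₁ (p , q)) eq))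
      cases (inj₂ p) (inj₂ q) (inj₁ _) = ⊥-elim (f≢g (same-kind-≡ all f g (inj₂ (p , q)) eq))
      cases (inj₁ _) (inj₂ q) (inj₂ r) = ⊥-elim (g≢h (same-kind-≡ all g h (inj₂ (q , r)) eq′))
      cases (inj₂ _) (inj₁ q) (inj₁ r) = ⊥-elim (g≢h (same-kind-≡ all g h (inj₁ (q , r)) eq′))

    compose-anti : ∀ g h → Antimorphism (elem g) → OppositeKind (elem (proj₁ (composite g h))) (elem h)
    compose-anti g h anti with composite g h | inAM h
    ... | l , l≗ | inj₁ m = inj₂ ((λ x y → trans (l≗ (x ++ y)) (trans (cong (elem g) (m x y))
            (trans (anti _ _) (sym (cong₂ _++_ (l≗ y) (l≗ x)))))) , m)
    ... | l , l≗ | inj₂ m = inj₁ ((λ x y → trans (l≗ (x ++ y)) (trans (cong (elem g) (m x y))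
            (trans (anti _ _) (sym (cong₂ _++_ (l≗ x) (l≗ y)))))) , m)

    transport : ∀ {v w} g h → elem g v ≡ elem h w → ∃[ f ] elem f v ≡ w
    transport {v} {w} g h eq with inverse h
    ... | h⁻¹ , _ , left with composite h⁻¹ g
    ...   | f , f≗ = f , trans (f≗ v) (trans (cong (elem h⁻¹) eq) (left w))

    module _ {a b : Fin k} (a≢b : a ≢ b) where
      -- Over a one-letter alphabet the two notions coincide; two letters separate them, because the
      -- words `ab` and `ba` would have the same image.
      ¬morphism×antimorphism : ∀ g → Morphism (elem g) → ¬ Antimorphism (elem g)
      ¬morphism×antimorphism g m am =
        a≢b (∷-injectiveˡ (elem-injective g (trans (m [ a ] [ b ]) (sym (am [ b ] [ a ])))))

      opposite⇒≢ : ∀ {g h} → OppositeKind (elem g) (elem h) → g ≢ h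
      opposite⇒≢ {g} (inj₁ (m , am)) refl = ¬morphism×antimorphism g m am
      opposite⇒≢ {g} (inj₂ (am , m)) refl = ¬morphism×antimorphism g m am

    module _ (u : InfWord k) where

      -- Here and in the next lemma, `i′` is a position where the image of a long factor occurs. A
      -- morphism keeps the offset `a` of an inner factor; an antimorphism replaces it by `b`, the
      -- distance to the right end.
      image-factor-morphism : ∀ g {i i′ t} a {m b} → Morphism (elem g) → t ≡ a + (m + b) →
        elem g (factor u i t) ≡ factor u i′ t → factor u (i′ + a) m ≡ elem g (factor u (i + a) m)
      image-factor-morphism g {i} a {m} {b} mo refl eq = sym (factor-middle u a refl (elem g (factor u i a)) (elem g (factor u (i + a) m))
        (trans (length-elem g _) (length-factor u i a)) (trans (length-elem g _) (length-factor u (i + a) m))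
        (trans (sym eq) (trans (cong (elem g) (factor-split₃ u i a m b)) (morph₃ (elem g) mo (factor u i a) (factor u (i + a) m) (factor u (i + a + m) b)))))

      image-factor-antimorphism : ∀ g {i i′ t} a {m b} → Antimorphism (elem g) → t ≡ a + (m + b) →
        elem g (factor u i t) ≡ factor u i′ t → factor u (i′ + b) m ≡ elem g (factor u (i + a) m)
      image-factor-antimorphism g {i} a {m} {b} an refl eq = sym (factor-middle u b
        (trans (+-comm a (m + b)) (trans (cong (_+ a) (+-comm m b)) (+-assoc b m a)))
        (elem g (factor u (i + a + m) b)) (elem g (factor u (i + a) m))
        (trans (length-elem g _) (length-factor u _ b)) (trans (length-elem g _) (length-factor u (i + a) m))
        (trans (sym eq) (trans (cong (elem g) (factor-split₃ u i a m b)) (anti₃ (elem g) an (factor u i a) (factor u (i + a) m) (factor u (i + a + m) b)))))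

      module _ (invariant : InvariantUnder u G) where
        private
          letter-image : ∀ g a → ∃[ a′ ] elem g [ a ] ≡ [ a′ ]
          letter-image g a = length-1 (elem g [ a ]) (length-elem g [ a ])

          letter-image-≢ : ∀ g {a b a′ b′} → elem g [ a ] ≡ [ a′ ] → elem g [ b ] ≡ [ b′ ] → a ≢ b → a′ ≢ b′
          letter-image-≢ g ea eb a≢b refl = a≢b (∷-injectiveˡ (elem-injective g (trans ea (sym eb))))

        -- An antimorphism exchanges left and right special factors, which is why invariance is
        -- stated for the union of the two.
        Special-image : ∀ g {w} → Special u w → Special u (elem g w)
        Special-image g {w} (inj₁ (a , b , a≢b , aw , bw)) with letter-image g a | letter-image g b | inAM g
        ... | a′ , ea | b′ , eb | inj₁ m = inj₁ (a′ , b′ , letter-image-≢ g ea eb a≢b ,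
          subst (𝓛 u) (trans (m [ a ] w) (cong (_++ elem g w) ea)) (invariant g _ aw) ,
          subst (𝓛 u) (trans (m [ b ] w) (cong (_++ elem g w) eb)) (invariant g _ bw))
        ... | a′ , ea | b′ , eb | inj₂ m = inj₂ (a′ , b′ , letter-image-≢ g ea eb a≢b ,
          subst (𝓛 u) (trans (m [ a ] w) (cong (elem g w ++_) ea)) (invariant g _ aw) ,
          subst (𝓛 u) (trans (m [ b ] w) (cong (elem g w ++_) eb)) (invariant g _ bw))
        Special-image g {w} (inj₂ (a , b , a≢b , wa , wb)) with letter-image g a | letter-image g b | inAM g
        ... | a′ , ea | b′ , eb | inj₁ m = inj₂ (a′ , b′ , letter-image-≢ g ea eb a≢b ,
          subst (𝓛 u) (trans (m w [ a ]) (cong (elem g w ++_) ea)) (invariant g _ wa) ,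
          subst (𝓛 u) (trans (m w [ b ]) (cong (elem g w ++_) eb)) (invariant g _ wb))
        ... | a′ , ea | b′ , eb | inj₂ m = inj₁ (a′ , b′ , letter-image-≢ g ea eb a≢b ,
          subst (𝓛 u) (trans (m w [ a ]) (cong (_++ elem g w) ea)) (invariant g _ wa) ,
          subst (𝓛 u) (trans (m w [ b ]) (cong (_++ elem g w) eb)) (invariant g _ wb))

        Special-preimage : ∀ g {w} → Special u (elem g w) → Special u w
        Special-preimage g {w} sp with inverse g
        ... | h , _ , left = subst (Special u) (left w) (Special-image h sp)

-- Frequencies of factors: Kirchhoff's law and invariance under the group

module Frequency where
  open import Data.Nat using (ℕ; zero; suc; _+_; _*_; _≤_; _<_; z≤n; s≤s; NonZero)
  import Data.Nat as ℕ
  open import Data.Nat.Properties hiding (_≟_)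
  open import Data.Integer as ℤ using (+_; +[1+_]; -[1+_])
  import Data.Integer.Properties as ℤₚ
  open import Data.Rational as ℚ using (0ℚ; ½; mkℚ; ∣_∣; _/_)
  import Data.Rational.Properties as ℚₚ
  import Data.Rational.Unnormalised as ℚᵘ
  import Data.Rational.Unnormalised.Properties as ℚᵘₚ
  open import Data.Rational.Solver using (module +-*-Solver)
  open import Data.Fin using (Fin; zero; suc)
  import Data.Fin.Properties as Finₚ
  open import Data.List using (List; []; _∷_; [_]; _++_; map; length; filter; tails)
  open import Data.List.Properties using (length-++; length-map; ∷-injective; ∷-injectiveʳ; ++-cancelʳ)
  open import Data.List.Membership.Propositional using (_∈_)
  open import Data.List.Membership.Propositional.Properties using (∈-++⁺ˡ; ∈-++⁺ʳ; ∈-++⁻; ∈-map⁺; ∈-map⁻)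
  open import Data.List.Relation.Binary.Prefix.Heterogeneous using (Prefix; []; _∷_)
  open import Data.List.Relation.Binary.Prefix.Heterogeneous.Properties using (prefix?)
  open import Data.List.Relation.Unary.All using ([]; _∷_)
  open import Data.List.Relation.Unary.AllPairs using ([]; _∷_)
  open import Data.List.Relation.Unary.Any using (here)
  open import Data.List.Relation.Unary.Unique.Propositional using (Unique)
  import Data.List.Relation.Unary.Unique.Propositional.Properties as Uniqueₚ
  open import Data.Product using (∃-syntax; _×_; _,_; proj₁; proj₂; swap)
  open import Data.Sum using (_⊎_; inj₁; inj₂)
  open import Data.Empty using (⊥-elim)
  open import Function using (_∘_)
  open import Relation.Binary.PropositionalEquality hiding ([_])
  open import Relation.Nullary using (¬_; Dec; yes; no)
  open import Relation.Unary using (Pred; Decidable)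
  open Counting
  open Words

  indicator : ∀ {p} {P : Set p} → Dec P → ℕ
  indicator (yes _) = 1
  indicator (no _)  = 0

  indicator≤1 : ∀ {p} {P : Set p} (d : Dec P) → indicator d ≤ 1
  indicator≤1 (yes _) = s≤s z≤n
  indicator≤1 (no _)  = z≤n

  indicator-⇔ : ∀ {p q} {P : Set p} {Q : Set q} (d : Dec P) (e : Dec Q) →
    (P → Q) → (Q → P) → indicator d ≡ indicator e
  indicator-⇔ (yes p) (yes q) f g = refl
  indicator-⇔ (yes p) (no ¬q) f g = ⊥-elim (¬q (f p))
  indicator-⇔ (no ¬p) (yes q) f g = ⊥-elim (¬p (g q))
  indicator-⇔ (no ¬p) (no ¬q) f g = refl

  length-filter-∷ : ∀ {a p} {A : Set a} {P : Pred A p} (P? : Decidable P) x xs →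
    length (filter P? (x ∷ xs)) ≡ indicator (P? x) + length (filter P? xs)
  length-filter-∷ P? x xs with P? x
  ... | yes _ = refl
  ... | no  _ = refl

  module _ {k : ℕ} where

    _⊑_ : Word k → Word k → Set
    _⊑_ = Prefix _≡_

    _⊑?_ : (w v : Word k) → Dec (w ⊑ v)
    _⊑?_ = prefix? Finₚ._≟_

    ⊑⇒++ : ∀ {w v} → w ⊑ v → ∃[ z ] v ≡ w ++ z
    ⊑⇒++ {v = v} []        = v , refl
    ⊑⇒++ (refl ∷ p) with ⊑⇒++ p
    ... | z , refl = z , refl

    ++⇒⊑ : ∀ w {z} → w ⊑ (w ++ z)
    ++⇒⊑ []      = []
    ++⇒⊑ (_ ∷ w) = refl ∷ ++⇒⊑ w

    occurrences-∷ : ∀ w c v → occurrences w (c ∷ v) ≡ indicator (w ⊑? (c ∷ v)) + occurrences w v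
    occurrences-∷ w c v = length-filter-∷ (w ⊑?_) (c ∷ v) (tails v)

    occurrences-[] : ∀ w → occurrences w [] ≡ indicator (w ⊑? [])
    occurrences-[] w = trans (length-filter-∷ (w ⊑?_) [] []) (+-identityʳ _)

    private
      atStart : ∀ {p} {P : Set p} → Dec P → List (Word k)
      atStart (yes _) = [] ∷ []
      atStart (no _)  = []

      length-atStart : ∀ {p} {P : Set p} (d : Dec P) → length (atStart d) ≡ indicator d
      length-atStart (yes _) = refl
      length-atStart (no _)  = refl

      atStart-unique : ∀ {p} {P : Set p} (d : Dec P) → Unique (atStart d)
      atStart-unique (yes _) = [] ∷ []
      atStart-unique (no _)  = []

      ∈-atStart⁺ : ∀ {p} {P : Set p} (d : Dec P) → P → [] ∈ atStart d
      ∈-atStart⁺ (yes _) p = here refl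
      ∈-atStart⁺ (no ¬p) p = ⊥-elim (¬p p)

      ∈-atStart⁻ : ∀ {p} {P : Set p} (d : Dec P) {x} → x ∈ atStart d → x ≡ [] × P
      ∈-atStart⁻ (yes p) (here refl) = refl , p

    -- The words preceding the occurrences of w in v.
    contexts : Word k → Word k → List (Word k)
    contexts w []      = atStart (w ⊑? [])
    contexts w (c ∷ v) = atStart (w ⊑? (c ∷ v)) ++ map (c ∷_) (contexts w v)

    length-contexts : ∀ w v → length (contexts w v) ≡ occurrences w v
    length-contexts w []      = trans (length-atStart (w ⊑? [])) (sym (occurrences-[] w))
    length-contexts w (c ∷ v) = begin
      length (contexts w (c ∷ v))                                            ≡⟨ length-++ (atStart (w ⊑? (c ∷ v))) ⟩
      length (atStart (w ⊑? (c ∷ v))) + length (map (c ∷_) (contexts w v))   ≡⟨ cong₂ _+_ (length-atStart (w ⊑? (c ∷ v))) (trans (length-map _ (contexts w v)) (length-contexts w v)) ⟩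
      indicator (w ⊑? (c ∷ v)) + occurrences w v                             ≡⟨ occurrences-∷ w c v ⟨
      occurrences w (c ∷ v)                                                  ∎
      where open ≡-Reasoning

    contexts-unique : ∀ w v → Unique (contexts w v)
    contexts-unique w []      = atStart-unique (w ⊑? [])
    contexts-unique w (c ∷ v) = Uniqueₚ.++⁺ (atStart-unique (w ⊑? (c ∷ v)))
      (Uniqueₚ.map⁺ ∷-injectiveʳ (contexts-unique w v)) disjoint
      where
      disjoint : ∀ {x} → ¬ (x ∈ atStart (w ⊑? (c ∷ v)) × x ∈ map (c ∷_) (contexts w v))
      disjoint (p , q) with ∈-atStart⁻ (w ⊑? (c ∷ v)) p | ∈-map⁻ (c ∷_) q
      ... | refl , _ | _ , _ , ()

    ∈-contexts⁺ : ∀ w {v} x z → v ≡ x ++ w ++ z → x ∈ contexts w v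
    ∈-contexts⁺ w {[]}    []      z eq = ∈-atStart⁺ (w ⊑? []) (subst (w ⊑_) (sym eq) (++⇒⊑ w))
    ∈-contexts⁺ w {c ∷ v} []      z eq = ∈-++⁺ˡ (∈-atStart⁺ (w ⊑? (c ∷ v)) (subst (w ⊑_) (sym eq) (++⇒⊑ w)))
    ∈-contexts⁺ w {c ∷ v} (_ ∷ x) z eq with ∷-injective eq
    ... | refl , eq′ = ∈-++⁺ʳ (atStart (w ⊑? (c ∷ v))) (∈-map⁺ (c ∷_) (∈-contexts⁺ w x z eq′))

    ∈-contexts⁻ : ∀ w v {x} → x ∈ contexts w v → ∃[ z ] v ≡ x ++ w ++ z
    ∈-contexts⁻ w [] x∈ with ∈-atStart⁻ (w ⊑? []) x∈
    ... | refl , p = ⊑⇒++ p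
    ∈-contexts⁻ w (c ∷ v) x∈ with ∈-++⁻ (atStart (w ⊑? (c ∷ v))) x∈
    ... | inj₁ q with ∈-atStart⁻ (w ⊑? (c ∷ v)) q
    ...   | refl , p = ⊑⇒++ p
    ∈-contexts⁻ w (c ∷ v) x∈ | inj₂ q with ∈-map⁻ (c ∷_) q
    ... | x , x∈′ , refl with ∈-contexts⁻ w v x∈′
    ...   | z , eq = z , cong (c ∷_) eq

    -- An occurrence is recorded by the word `x` before it. A morphism sends it to the occurrence
    -- preceded by `φ x`, an antimorphism to the one preceded by `φ z`, where `z` is the word after
    -- it; `z` determines `x` by cancellation in `v`.
    occurrences-≤ : ∀ {φ : Word k → Word k} → (∀ {x y} → φ x ≡ φ y → x ≡ y) →
      Morphism φ ⊎ Antimorphism φ → ∀ w v → occurrences w v ≤ occurrences (φ w) (φ v)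
    occurrences-≤ {φ} φ-injective kind w v =
      subst₂ _≤_ (length-contexts w v) (length-contexts (φ w) (φ v)) (go kind)
      where
      go : Morphism φ ⊎ Antimorphism φ → length (contexts w v) ≤ length (contexts (φ w) (φ v))
      go (inj₁ m) = length-≤ (λ x y → y ≡ φ x) (contexts-unique w v)
        (λ {x} x∈ → φ x , ∈-contexts⁺ (φ w) (φ x) _
          (trans (cong φ (proj₂ (∈-contexts⁻ w v x∈))) (morph₃ φ m x w _)) , refl)
        (λ p q → φ-injective (trans (sym p) q))
      go (inj₂ m) = length-≤ (λ x y → ∃[ z ] v ≡ x ++ w ++ z × y ≡ φ z) (contexts-unique w v)
        (λ {x} x∈ → let z , eq = ∈-contexts⁻ w v x∈ in
          φ z , ∈-contexts⁺ (φ w) (φ z) (φ x) (trans (cong φ eq) (anti₃ φ m x w z)) , z , eq , refl)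
        injective
        where
        injective : ∀ {x x′ y} → ∃[ z ] v ≡ x ++ w ++ z × y ≡ φ z → ∃[ z ] v ≡ x′ ++ w ++ z × y ≡ φ z → x ≡ x′
        injective {x} {x′} (z , eq , p) (z′ , eq′ , q) with φ-injective (trans (sym p) q)
        ... | refl = ++-cancelʳ (w ++ z) x x′ (trans (sym eq) eq′)

    module _ (u : InfWord k) where

      -- Inside a factor of `u`, every occurrence of `w` except one at the very start is preceded by
      -- a letter, which can only be `a`.
      occurrences-left : ∀ {a w} → (∀ c → 𝓛 u (c ∷ w) → c ≡ a) → ∀ v → 𝓛 u v →
        occurrences w v ≡ indicator (w ⊑? v) + occurrences (a ∷ w) v
      occurrences-left {a} {w} unique []      occ =
        trans (occurrences-[] w) (trans (sym (+-identityʳ _)) (cong (λ o → indicator (w ⊑? []) + o) (sym (occurrences-[] (a ∷ w)))))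
      occurrences-left {a} {w} unique (c ∷ v) occ = begin
        occurrences w (c ∷ v)                                                       ≡⟨ occurrences-∷ w c v ⟩
        indicator (w ⊑? (c ∷ v)) + occurrences w v                                  ≡⟨ cong (λ o → indicator (w ⊑? (c ∷ v)) + o) (occurrences-left unique v (proj₂ (𝓛-++ u [ c ] v occ))) ⟩
        indicator (w ⊑? (c ∷ v)) + (indicator (w ⊑? v) + occurrences (a ∷ w) v)
          ≡⟨ cong (λ i → indicator (w ⊑? (c ∷ v)) + (i + occurrences (a ∷ w) v)) (indicator-⇔ (w ⊑? v) ((a ∷ w) ⊑? (c ∷ v)) extend λ { (_ ∷ p) → p }) ⟩
        indicator (w ⊑? (c ∷ v)) + (indicator ((a ∷ w) ⊑? (c ∷ v)) + occurrences (a ∷ w) v) ≡⟨ cong (λ o → indicator (w ⊑? (c ∷ v)) + o) (occurrences-∷ (a ∷ w) c v) ⟨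
        indicator (w ⊑? (c ∷ v)) + occurrences (a ∷ w) (c ∷ v)                      ∎
        where
        open ≡-Reasoning
        extend : w ⊑ v → (a ∷ w) ⊑ (c ∷ v)
        extend p with ⊑⇒++ p
        ... | z , refl = sym (unique c (proj₁ (𝓛-++ u (c ∷ w) z occ))) ∷ p

  -- Estimates for rationals and reals

  module _ {l : ℕ} .{{_ : NonZero l}} where

    toℚᵘ-/ : ∀ i → ℚ.toℚᵘ (i / l) ℚᵘ.≃ (i ℚᵘ./ l)
    toℚᵘ-/ i = go l
      where
      go : ∀ l .{{_ : NonZero l}} → ℚ.toℚᵘ (i / l) ℚᵘ.≃ (i ℚᵘ./ l)
      go (suc l) = ℚₚ.toℚᵘ-fromℚᵘ (ℚᵘ.mkℚᵘ i l)

    /-suc : ∀ b → + suc b / l ≡ + 1 / l ℚ.+ + b / l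
    /-suc b = ℚₚ.toℚᵘ-injective (begin
      ℚ.toℚᵘ (+ suc b / l)                        ≈⟨ toℚᵘ-/ (+ suc b) ⟩
      (+ suc b) ℚᵘ./ l                            ≈⟨ go l ⟩
      (+ 1) ℚᵘ./ l ℚᵘ.+ (+ b) ℚᵘ./ l              ≈⟨ ℚᵘₚ.+-cong (toℚᵘ-/ (+ 1)) (toℚᵘ-/ (+ b)) ⟨
      ℚ.toℚᵘ (+ 1 / l) ℚᵘ.+ ℚ.toℚᵘ (+ b / l)      ≈⟨ ℚₚ.toℚᵘ-homo-+ (+ 1 / l) (+ b / l) ⟨
      ℚ.toℚᵘ (+ 1 / l ℚ.+ + b / l)                ∎)
      where
      open ℚᵘₚ.≃-Reasoning
      open import Data.Integer.Tactic.RingSolver using (solve-∀)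
      go : ∀ l .{{_ : NonZero l}} → (+ suc b) ℚᵘ./ l ℚᵘ.≃ (+ 1) ℚᵘ./ l ℚᵘ.+ (+ b) ℚᵘ./ l
      go (suc l) = ℚᵘ.*≡* (identity (+ b) (+ suc l))
        where
        identity : ∀ b l → (+ 1 ℤ.+ b) ℤ.* (l ℤ.* l) ≡ (+ 1 ℤ.* l ℤ.+ b ℤ.* l) ℤ.* l
        identity = solve-∀

    0≤1/ : 0ℚ ℚ.≤ + 1 / l
    0≤1/ = ℚₚ.toℚᵘ-cancel-≤ (ℚᵘₚ.≤-respʳ-≃ (ℚᵘₚ.≃-sym (toℚᵘ-/ (+ 1))) (go l))
      where
      go : ∀ l .{{_ : NonZero l}} → ℚ.toℚᵘ 0ℚ ℚᵘ.≤ (+ 1) ℚᵘ./ l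
      go (suc l) = ℚᵘ.*≤* (ℤ.+≤+ z≤n)

    private
      ∣p-q∣ : ∀ p q r → p ≡ r ℚ.+ q → p ℚ.- q ≡ r
      ∣p-q∣ p q r refl = solve 2 (λ r q → (r :+ q) :- q := r) refl r q
        where open +-*-Solver

      ∣q-p∣ : ∀ p q r → p ≡ r ℚ.+ q → q ℚ.- p ≡ ℚ.- r
      ∣q-p∣ p q r refl = solve 2 (λ r q → q :- (r :+ q) := :- r) refl r q
        where open +-*-Solver

      ∣1/∣ : ∣ + 1 / l ∣ ≡ + 1 / l
      ∣1/∣ = ℚₚ.0≤p⇒∣p∣≡p 0≤1/

    quotients-close : ∀ a b → a ≤ suc b → b ≤ suc a → ∣ + a / l ℚ.- + b / l ∣ ℚ.≤ + 1 / l
    quotients-close a b a≤1+b b≤1+a with m≤n⇒m<n∨m≡n a≤1+b | m≤n⇒m<n∨m≡n b≤1+a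
    ... | inj₂ refl | _ = ℚₚ.≤-reflexive (trans (cong ∣_∣ (∣p-q∣ (+ a / l) _ _ (/-suc b))) ∣1/∣)
    ... | inj₁ _ | inj₂ refl = ℚₚ.≤-reflexive (trans (cong ∣_∣ (∣q-p∣ (+ b / l) _ _ (/-suc a)))
                                   (trans (ℚₚ.∣-p∣≡∣p∣ (+ 1 / l)) ∣1/∣))
    ... | inj₁ (s≤s a≤b) | inj₁ (s≤s b≤a) rewrite ≤-antisym a≤b b≤a =
      subst (ℚ._≤ + 1 / l) (sym (cong ∣_∣ (ℚₚ.+-inverseʳ (+ b / l)))) 0≤1/

  archimedean : ∀ ε → 0ℚ ℚ.< ε → ∃[ M ] (∀ l .{{_ : NonZero l}} → M ≤ l → + 1 / l ℚ.< ε)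
  archimedean (mkℚ (+ zero)   d c) (ℚ.*<* (ℤ.+<+ ()))
  archimedean (mkℚ -[1+ _ ]   d c) (ℚ.*<* ())
  -- The denominator of `ε` is `suc d` and its numerator is at least 1, so 1/l is below `ε` as soon
  -- as `l` exceeds `suc d`.
  archimedean ε@(mkℚ +[1+ p ] d c) _ = suc (suc d) , λ l d<l →
    ℚₚ.toℚᵘ-cancel-< (ℚᵘₚ.<-respˡ-≃ (ℚᵘₚ.≃-sym (toℚᵘ-/ (+ 1))) (go l d<l))
    where
    go : ∀ l .{{_ : NonZero l}} → suc (suc d) ≤ l → (+ 1) ℚᵘ./ l ℚᵘ.< ℚ.toℚᵘ ε
    go (suc l) d<l = ℚᵘ.*<* (subst₂ ℤ._<_ (ℤₚ.pos-* 1 (suc d)) (ℤₚ.pos-* (suc p) (suc l))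
      (ℤ.+<+ (≤-trans (subst (λ x → suc x ≤ suc l) (sym (*-identityˡ (suc d))) d<l) (m≤m+n (suc l) (p ℕ.* suc l)))))

  distance-triangle : ∀ p q r → ∣ p ℚ.- r ∣ ℚ.≤ ∣ p ℚ.- q ∣ ℚ.+ ∣ q ℚ.- r ∣
  distance-triangle p q r = ℚₚ.≤-trans (ℚₚ.≤-reflexive (cong ∣_∣ (split p q r))) (ℚₚ.∣p+q∣≤∣p∣+∣q∣ (p ℚ.- q) (q ℚ.- r))
    where
    open +-*-Solver
    split : ∀ p q r → p ℚ.- r ≡ (p ℚ.- q) ℚ.+ (q ℚ.- r)
    split = solve 3 (λ p q r → p :- r := (p :- q) :+ (q :- r)) refl

  distance-sym : ∀ p q → ∣ p ℚ.- q ∣ ≡ ∣ q ℚ.- p ∣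
  distance-sym p q = trans (cong ∣_∣ (solve 2 (λ p q → p :- q := :- (q :- p)) refl p q)) (ℚₚ.∣-p∣≡∣p∣ (q ℚ.- p))
    where open +-*-Solver

  halves : ∀ ε → ½ ℚ.* ε ℚ.+ ½ ℚ.* ε ≡ ε
  halves ε = trans (sym (ℚₚ.*-distribʳ-+ ε ½ ½)) (ℚₚ.*-identityˡ ε)

  half-positive : ∀ {ε} → 0ℚ ℚ.< ε → 0ℚ ℚ.< ½ ℚ.* ε
  half-positive = ℚₚ.*-monoʳ-<-pos ½

  Close-common : ∀ {ε q ρ σ} → Close (½ ℚ.* ε) (fromℚ q) ρ → Close (½ ℚ.* ε) (fromℚ q) σ → Close ε ρ σ
  Close-common {ε} {q} {ρ} {σ} (K , near) (K′ , near′) = K ℕ.⊔ K′ , λ j K≤j → begin-strict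
    ∣ seq ρ j ℚ.- seq σ j ∣                     ≤⟨ distance-triangle (seq ρ j) q (seq σ j) ⟩
    ∣ seq ρ j ℚ.- q ∣ ℚ.+ ∣ q ℚ.- seq σ j ∣     ≡⟨ cong (ℚ._+ ∣ q ℚ.- seq σ j ∣) (distance-sym (seq ρ j) q) ⟩
    ∣ q ℚ.- seq ρ j ∣ ℚ.+ ∣ q ℚ.- seq σ j ∣     <⟨ ℚₚ.+-mono-< (near j (≤-trans (m≤m⊔n K K′) K≤j)) (near′ j (≤-trans (m≤n⊔m K K′) K≤j)) ⟩
    ½ ℚ.* ε ℚ.+ ½ ℚ.* ε                         ≡⟨ halves ε ⟩
    ε                                           ∎
    where open ℚₚ.≤-Reasoning

  Close-shift : ∀ {ε} p q {ρ} → ∣ p ℚ.- q ∣ ℚ.< ½ ℚ.* ε → Close (½ ℚ.* ε) (fromℚ q) ρ → Close ε (fromℚ p) ρ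
  Close-shift {ε} p q {ρ} p≈q (K , near) = K , λ j K≤j → begin-strict
    ∣ p ℚ.- seq ρ j ∣                       ≤⟨ distance-triangle p q (seq ρ j) ⟩
    ∣ p ℚ.- q ∣ ℚ.+ ∣ q ℚ.- seq ρ j ∣       <⟨ ℚₚ.+-mono-< p≈q (near j K≤j) ⟩
    ½ ℚ.* ε ℚ.+ ½ ℚ.* ε                     ≡⟨ halves ε ⟩
    ε                                       ∎
    where open ℚₚ.≤-Reasoning

  module _ {k : ℕ} (u : InfWord k) where

    long-factor : ∀ M → ∃[ v ] 𝓛 u v × M ≤ length v × NonZero (length v)
    -- One letter more than required, so that the factor is non-empty even when `M` is 0.
    long-factor M = factor u 0 (suc M) , factor∈𝓛 u 0 (suc M) ,
      subst (M ≤_) (sym (length-factor u 0 (suc M))) (n≤1+n M) , _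

    -- A record, so that unification does not unfold the rational arithmetic in IsFrequency.
    record HasFrequency (w : Word k) (ρ : ℝ) : Set where
      constructor hasFrequency
      field isFrequency : IsFrequency u w ρ

    open HasFrequency

    -- Both limits are compared with the same quotient, taken on one factor long enough for both.
    HasFrequency-unique : ∀ {w ρ σ} → HasFrequency w ρ → HasFrequency w σ → ρ ≃ σ
    HasFrequency-unique {w} {ρ} {σ} fρ fσ ε 0<ε =
      let M , near = isFrequency fρ (½ ℚ.* ε) (half-positive 0<ε)
          M′ , near′ = isFrequency fσ (½ ℚ.* ε) (half-positive 0<ε)
          v , occ , long , nz = long-factor (M + M′)
      in Close-common {q = (+ occurrences w v / length v) {{nz}}} {ρ} {σ}
        (near v {{nz}} occ (≤-trans (m≤m+n M M′) long)) (near′ v {{nz}} occ (≤-trans (m≤n+m M′ M) long))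

    -- A difference of at most one in the counts changes the quotient by at most 1/∣v∣, which tends
    -- to 0.
    HasFrequency-near : ∀ w w′ {ρ} →
      (∀ v → 𝓛 u v → occurrences w v ≤ suc (occurrences w′ v) × occurrences w′ v ≤ suc (occurrences w v)) →
      HasFrequency w ρ → HasFrequency w′ ρ
    HasFrequency-near w w′ {ρ} near f = hasFrequency λ ε 0<ε →
      let M , close = isFrequency f (½ ℚ.* ε) (half-positive 0<ε)
          M′ , small = archimedean (½ ℚ.* ε) (half-positive 0<ε)
      in M ℕ.⊔ M′ , λ v occ long →
        Close-shift (+ occurrences w′ v / length v) (+ occurrences w v / length v) {ρ}
          (ℚₚ.≤-<-trans
            (quotients-close (occurrences w′ v) (occurrences w v) (proj₂ (near v occ)) (proj₁ (near v occ)))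
            (small (length v) (≤-trans (m≤n⊔m M M′) long)))
          (close v occ (≤-trans (m≤m⊔n M M′) long))

    module _ {a : Fin k} {w : Word k} (unique : ∀ c → 𝓛 u (c ∷ w) → c ≡ a) where
      private
        near : ∀ v → 𝓛 u v → occurrences w v ≤ suc (occurrences (a ∷ w) v) × occurrences (a ∷ w) v ≤ suc (occurrences w v)
        near v occ rewrite occurrences-left u unique v occ =
          +-monoˡ-≤ (occurrences (a ∷ w) v) (indicator≤1 (w ⊑? v)) , m≤n⇒m≤1+n (m≤n+m _ (indicator (w ⊑? v)))

      -- Kirchhoff's law at a vertex with a single incoming arrow; the two counts differ only by a
      -- possible occurrence at the start of `v`.
      HasFrequency-∷⁺ : ∀ {ρ} → HasFrequency w ρ → HasFrequency (a ∷ w) ρ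
      HasFrequency-∷⁺ = HasFrequency-near w (a ∷ w) near

      HasFrequency-∷⁻ : ∀ {ρ} → HasFrequency (a ∷ w) ρ → HasFrequency w ρ
      HasFrequency-∷⁻ = HasFrequency-near (a ∷ w) w (λ v occ → swap (near v occ))

    module _ (G : FiniteSubgroupAM k) (invariant : InvariantUnder u G) where
      open FiniteSubgroupAM G
      open GroupAction G

      occurrences-elem : ∀ g w v → occurrences (elem g w) (elem g v) ≡ occurrences w v
      occurrences-elem g w v with inverse g
      ... | h , _ , left = ≤-antisym
        (subst₂ (λ x y → occurrences (elem g w) (elem g v) ≤ occurrences x y) (left w) (left v)
          (occurrences-≤ (elem-injective h) (inAM h) (elem g w) (elem g v)))
        (occurrences-≤ (elem-injective g) (inAM g) w v)

      private
        quotient-cong : ∀ {a b l m} .{{_ : NonZero l}} .{{_ : NonZero m}} → a ≡ b → l ≡ m → + a / l ≡ + b / m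
        quotient-cong refl refl = refl

      -- Counting `elem g w` in `v` amounts to counting `w` in the image of `v` under the inverse of
      -- `g`, which is again a factor of `u`, of the same length.
      HasFrequency-elem : ∀ g {w ρ} → HasFrequency w ρ → HasFrequency (elem g w) ρ
      HasFrequency-elem g {w} {ρ} f = hasFrequency λ ε 0<ε →
        let M , close = isFrequency f ε 0<ε
        in M , λ v occ long →
          subst (λ q → Close ε (fromℚ q) ρ)
            (quotient-cong {{nonZero v}}
              (trans (sym (occurrences-elem g w (elem h v))) (cong (occurrences (elem g w)) (right v)))
              (length-elem h v))
            (close (elem h v) {{nonZero v}} (invariant h v occ) (subst (M ≤_) (sym (length-elem h v)) long))
        where
        h = proj₁ (inverse g)
        right = proj₁ (proj₂ (inverse g))
        nonZero : ∀ v .{{_ : NonZero (length v)}} → NonZero (length (elem h v))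
        nonZero v = subst NonZero (sym (length-elem h v)) (ℕ.>-nonZero (ℕ.>-nonZero⁻¹ (length v)))

      HasFrequency-elem⁻ : ∀ g {w ρ} → HasFrequency (elem g w) ρ → HasFrequency w ρ
      HasFrequency-elem⁻ g {w} {ρ} f with inverse g
      ... | h , _ , left = subst (λ x → HasFrequency x ρ) (left w) (HasFrequency-elem h f)

  -- The combinatorial part stays in ℕ, with every subtracted term moved to the other side; only
  -- here is it turned into the rational inequality with denominator #G.
  ≤-from-cross-multiplied : ∀ m o x y v w .{{_ : NonZero o}} → o * m + x + y + 4 * v ≤ 4 * w + o →
    + m / 1 ℚ.≤ (+ 4 ℤ.* (+ w ℤ.- + v) ℤ.+ + o ℤ.- + x ℤ.- + y) / o
  ≤-from-cross-multiplied m o@(suc _) x y v w le = ℚₚ.toℚᵘ-cancel-≤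
    (ℚᵘₚ.≤-respˡ-≃ (ℚᵘₚ.≃-sym (toℚᵘ-/ (+ m))) (ℚᵘₚ.≤-respʳ-≃ (ℚᵘₚ.≃-sym (toℚᵘ-/ (+ 4 ℤ.* (+ w ℤ.- + v) ℤ.+ + o ℤ.- + x ℤ.- + y))) (ℚᵘ.*≤* cross)))
    where
    open import Data.Integer.Tactic.RingSolver using (solve-∀)
    open ℤₚ.≤-Reasoning

    expand : ∀ m o x y v → m ℤ.* o ≡ (o ℤ.* m ℤ.+ x ℤ.+ y ℤ.+ + 4 ℤ.* v) ℤ.- x ℤ.- y ℤ.- + 4 ℤ.* v
    expand = solve-∀

    collect : ∀ o x y v w → (+ 4 ℤ.* w ℤ.+ o) ℤ.- x ℤ.- y ℤ.- + 4 ℤ.* v ≡ (+ 4 ℤ.* (w ℤ.- v) ℤ.+ o ℤ.- x ℤ.- y) ℤ.* + 1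
    collect = solve-∀

    leftℤ : + (o * m + x + y + 4 * v) ≡ + o ℤ.* + m ℤ.+ + x ℤ.+ + y ℤ.+ + 4 ℤ.* + v
    leftℤ = cong₂ (λ a b → a ℤ.+ + x ℤ.+ + y ℤ.+ b) (ℤₚ.pos-* o m) (ℤₚ.pos-* 4 v)

    rightℤ : + (4 * w + o) ≡ + 4 ℤ.* + w ℤ.+ + o
    rightℤ = cong (ℤ._+ + o) (ℤₚ.pos-* 4 w)

    cross : + m ℤ.* + o ℤ.≤ (+ 4 ℤ.* (+ w ℤ.- + v) ℤ.+ + o ℤ.- + x ℤ.- + y) ℤ.* + 1
    cross = begin
      + m ℤ.* + o                                                                                       ≡⟨ expand (+ m) (+ o) (+ x) (+ y) (+ v) ⟩
      (+ o ℤ.* + m ℤ.+ + x ℤ.+ + y ℤ.+ + 4 ℤ.* + v) ℤ.- + x ℤ.- + y ℤ.- + 4 ℤ.* + v                       ≤⟨ shift (subst₂ ℤ._≤_ leftℤ rightℤ (ℤ.+≤+ le)) ⟩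
      (+ 4 ℤ.* + w ℤ.+ + o) ℤ.- + x ℤ.- + y ℤ.- + 4 ℤ.* + v                                             ≡⟨ collect (+ o) (+ x) (+ y) (+ v) (+ w) ⟩
      (+ 4 ℤ.* (+ w ℤ.- + v) ℤ.+ + o ℤ.- + x ℤ.- + y) ℤ.* + 1                                           ∎
      where
      shift : ∀ {i j} → i ℤ.≤ j → i ℤ.- + x ℤ.- + y ℤ.- + 4 ℤ.* + v ℤ.≤ j ℤ.- + x ℤ.- + y ℤ.- + 4 ℤ.* + v
      shift = ℤₚ.+-monoˡ-≤ (ℤ.- (+ 4 ℤ.* + v)) ∘ ℤₚ.+-monoˡ-≤ (ℤ.- + y) ∘ ℤₚ.+-monoˡ-≤ (ℤ.- + x)

-- The reduced Rauzy graph and its counting inequalities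

module RauzyGraph where
  open import Data.Nat using (ℕ; zero; suc; _+_; _*_; _∸_; _≤_; _<_; z≤n; s≤s; z<s; s<s)
  open import Data.Nat.Induction using (<-rec)
  open import Data.Nat.Properties hiding (_≟_)
  import Data.Nat.Properties as ℕₚ
  open import Data.Fin using (Fin; zero; suc; toℕ; remQuot; combine)
  import Data.Fin as Fin
  import Data.Fin.Properties as Finₚ
  open import Data.List using (List; []; _∷_; [_]; _++_; map; length; filter; take; allFin)
  open import Data.List.Properties using (≡-dec; length-++; length-map; length-tabulate; ∷-injectiveˡ; ∷-injectiveʳ; ∷ʳ-injective)
  open import Data.List.Membership.Propositional using (_∈_)
  open import Data.List.Membership.Propositional.Properties using (∈-map⁻; ∈-filter⁺; ∈-filter⁻; ∈-allFin)
  open import Data.List.Relation.Unary.All as All using (All; []; _∷_)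
  import Data.List.Relation.Unary.Any as Any
  open import Data.List.Relation.Unary.Any.Properties using (lookup-index)
  open import Data.List.Relation.Unary.Unique.Propositional using (Unique)
  import Data.List.Relation.Unary.Unique.Propositional.Properties as Uniqueₚ
  open import Data.Product using (∃-syntax; _×_; _,_; proj₁; proj₂)
  open import Data.Sum using (_⊎_; inj₁; inj₂)
  open import Data.Empty using (⊥; ⊥-elim)
  open import Function using (_∘_; id; _⇔_; Equivalence)
  open import Relation.Binary using (tri<; tri≈; tri>)
  open import Relation.Binary.PropositionalEquality hiding ([_])
  open import Relation.Nullary using (¬_; Dec; yes; no; ¬?; _×-dec_; _⊎-dec_)
  open import Relation.Nullary.Decidable using (map′)
  open import Relation.Unary using (Decidable)
  open import Relation.Unary.Properties using (∁?)
  open Counting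
  open Words
  open Frequency

  ++-splitʳ : ∀ {a} {A : Set a} (xs xs′ : List A) {ys ys′ : List A} →
    length ys ≡ length ys′ → xs ++ ys ≡ xs′ ++ ys′ → ys ≡ ys′
  ++-splitʳ xs xs′ {ys} {ys′} le eq = proj₂ (++-split xs xs′ (+-cancelʳ-≡ (length ys) _ _ (begin
    length xs + length ys     ≡⟨ length-++ xs ⟨
    length (xs ++ ys)         ≡⟨ cong length eq ⟩
    length (xs′ ++ ys′)       ≡⟨ length-++ xs′ ⟩
    length xs′ + length ys′   ≡⟨ cong (length xs′ +_) le ⟨
    length xs′ + length ys    ∎)) eq)
    where open ≡-Reasoning

  take-++-length : ∀ {a} {A : Set a} (xs : List A) {ys} m → length xs ≡ m → take m (xs ++ ys) ≡ xs
  take-++-length []       zero    _  = refl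
  take-++-length (x ∷ xs) (suc m) le = cong (x ∷_) (take-++-length xs m (suc-injective le))

  -- Choosing one preimage per entry keeps the length, and the chosen list has no repetitions if
  -- `xs` has none. The list of reduced edges is obtained in this way.
  preimages : ∀ {a b q} {A : Set a} {B : Set b} {Q : B → Set q} (f : B → A) {xs} →
    All (λ x → ∃[ y ] Q y × f y ≡ x) xs → ∃[ ys ] map f ys ≡ xs × All Q ys
  preimages f []                     = [] , refl , []
  preimages f ((y , qy , fy≡x) ∷ ps) with preimages f ps
  ... | ys , eq , qs = y ∷ ys , cong₂ _∷_ fy≡x eq , qy ∷ qs

  module Recurrence {k : ℕ} (u : InfWord k) (recurrent : UniformlyRecurrent u) where

    recurs-after : ∀ {w} → 𝓛 u w → ∀ m → ∃[ j ] m ≤ j × OccursAt u w j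
    recurs-after (i , occ)     zero    = i , z≤n , occ
    recurs-after {w} w∈ (suc m) with recurs-after w∈ m
    ... | i , m≤i , occ with proj₂ (recurrent w w∈) i occ
    ...   | j , i<j , _ , occ′ = j , ≤-trans (s≤s m≤i) i<j , occ′

  module FixedLength {k : ℕ} (G : FiniteSubgroupAM k) (u : InfWord k)
    (recurrent : UniformlyRecurrent u) (aperiodic : Aperiodic u) (invariant : InvariantUnder u G)
    (θ : Fin (FiniteSubgroupAM.order G)) (θ-anti : Antimorphism (FiniteSubgroupAM.elem G θ))
    (n : ℕ) (letters : ∀ i → AllLetters (factor u i n))
    (vertices : List (Word k)) (vertices-unique : Unique vertices) (vertices-spec : ∀ w → w ∈ vertices ⇔ 𝓛ₙ u n w)
    (arrows : List (Word k)) (arrows-unique : Unique arrows) (arrows-spec : ∀ w → w ∈ arrows ⇔ 𝓛ₙ u (suc n) w)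
    where

    open FiniteSubgroupAM G
    open GroupAction G
    open Recurrence u recurrent

    _≟_ : (v w : Word k) → Dec (v ≡ w)
    _≟_ = ≡-dec Finₚ._≟_

    open import Data.List.Membership.DecPropositional _≟_ using (_∈?_)

    fac : ℕ → ℕ → Word k
    fac = factor u

    ∈-vertices : ∀ {w} → 𝓛 u w → length w ≡ n → w ∈ vertices
    ∈-vertices occ len = Equivalence.from (vertices-spec _) (occ , len)

    vertex-at : ∀ j → fac j n ∈ vertices
    vertex-at j = ∈-vertices (factor∈𝓛 u j n) (length-factor u j n)

    ∈-arrows : ∀ {w} → 𝓛 u w → length w ≡ suc n → w ∈ arrows
    ∈-arrows occ len = Equivalence.from (arrows-spec _) (occ , len)

    -- The only source of decidability for `𝓛`: the supplied list settles membership at length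
    -- `suc n`, and whether a factor of length `n` is special is a question about such words.
    arrow? : ∀ w → length w ≡ suc n → Dec (𝓛 u w)
    arrow? w len = map′ (proj₁ ∘ Equivalence.to (arrows-spec w)) (λ occ → ∈-arrows occ len) (w ∈? arrows)

    length-snoc : ∀ {m} (w : Word k) {a} → length w ≡ m → length (w ++ [ a ]) ≡ suc m
    length-snoc w len = trans (length-++ w) (trans (+-comm (length w) 1) (cong suc len))

    abstract
      LeftSpecial? : ∀ w → length w ≡ n → Dec (LeftSpecial u w)
      LeftSpecial? w len = Finₚ.any? λ a → Finₚ.any? λ b →
        ¬? (a Finₚ.≟ b) ×-dec arrow? (a ∷ w) (cong suc len) ×-dec arrow? (b ∷ w) (cong suc len)

    abstract
      RightSpecial? : ∀ w → length w ≡ n → Dec (RightSpecial u w)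
      RightSpecial? w len = Finₚ.any? λ a → Finₚ.any? λ b →
        ¬? (a Finₚ.≟ b) ×-dec arrow? (w ++ [ a ]) (length-snoc w len) ×-dec arrow? (w ++ [ b ]) (length-snoc w len)

    Special? : ∀ w → length w ≡ n → Dec (Special u w)
    Special? w len = LeftSpecial? w len ⊎-dec RightSpecial? w len

    abstract
      -- Filtering demands a decision for every word, while specialness is decided only at length
      -- `n`; so the length becomes part of the predicate.
      withLength? : {P : Word k → Set} → (∀ w → length w ≡ n → Dec (P w)) → Decidable (λ w → length w ≡ n × P w)
      withLength? P? w with length w ℕₚ.≟ n
      ... | no  len≢ = no (len≢ ∘ proj₁)
      ... | yes len≡ = map′ (len≡ ,_) proj₂ (P? w len≡)

    Sp : ℕ → Set
    Sp i = Special u (fac i n)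

    Sp? : Decidable Sp
    Sp? i = Special? (fac i n) (length-factor u i n)

    ¬Special-next : ∀ {i j} → ¬ Sp i → fac i n ≡ fac j n → u (i + n) ≡ u (j + n)
    ¬Special-next {i} {j} ¬sp eq with u (i + n) Finₚ.≟ u (j + n)
    ... | yes e = e
    ... | no  ≢ = ⊥-elim (¬sp (inj₂ (u (i + n) , u (j + n) , ≢ ,
        subst (𝓛 u) (factor-snoc u i n) (factor∈𝓛 u i (suc n)) ,
        subst (𝓛 u) (trans (factor-snoc u j n) (cong (_++ [ u (j + n) ]) (sym eq))) (factor∈𝓛 u j (suc n)))))

    ¬Special-extend : ∀ {i j} → ¬ Sp i → fac i n ≡ fac j n → fac i (suc n) ≡ fac j (suc n)
    ¬Special-extend {i} {j} ¬sp eq = trans (factor-snoc u i n)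
      (trans (cong₂ (λ w a → w ++ [ a ]) eq (¬Special-next ¬sp eq)) (sym (factor-snoc u j n)))

    fac-tail : ∀ {i j} → fac i (suc n) ≡ fac j (suc n) → fac (suc i) n ≡ fac (suc j) n
    fac-tail {i} {j} eq = ∷-injectiveʳ (trans (sym (factor-cons u i n)) (trans eq (factor-cons u j n)))

    -- A run of non-special factors longer than the number of vertices closes up
    -- to a cycle without exit, which would make u eventually periodic.
    special-ahead′ : ∀ i → ∃[ j ] i ≤ j × Sp j
    special-ahead′ i with Finₚ.any? (λ (a : Fin (suc (length vertices))) → Sp? (i + toℕ a))
    ... | yes (a , sp) = i + toℕ a , m≤m+n i (toℕ a) , sp
    ... | no none with Finₚ.pigeonhole (n<1+n (length vertices)) (λ a → Any.index (vertex-at (i + toℕ a)))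
    ... | a , b , a<b , same = ⊥-elim (aperiodic (suc d , x + n , z<s , periodic))
      where
      x = i + toℕ a
      gap = m≤n⇒∃[o]m+o≡n a<b
      d = proj₁ gap

      x+1+d : x + suc d ≡ i + toℕ b
      x+1+d = trans (+-assoc i (toℕ a) (suc d)) (cong (i +_) (trans (+-suc (toℕ a) d) (proj₂ gap)))

      returns : fac x n ≡ fac (x + suc d) n
      returns = begin
        fac x n              ≡⟨ lookup-index (vertex-at x) ⟩
        Data.List.lookup vertices (Any.index (vertex-at x))               ≡⟨ cong (Data.List.lookup vertices) same ⟩
        Data.List.lookup vertices (Any.index (vertex-at (i + toℕ b)))     ≡⟨ lookup-index (vertex-at (i + toℕ b)) ⟨
        fac (i + toℕ b) n    ≡⟨ cong (λ y → fac y n) x+1+d ⟨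
        fac (x + suc d) n    ∎
        where open ≡-Reasoning

      window : ∀ j → j < suc d → ¬ Sp (x + j)
      window j (s≤s j≤d) sp = none (Fin.fromℕ< bound , subst Sp position sp)
        where
        bound : toℕ a + j < suc (length vertices)
        bound = ≤-trans (s≤s (+-monoʳ-≤ (toℕ a) j≤d)) (≤-trans (≤-reflexive (proj₂ gap)) (<⇒≤ (Finₚ.toℕ<n b)))
        position : x + j ≡ i + toℕ (Fin.fromℕ< bound)
        position = trans (+-assoc i (toℕ a) j) (cong (i +_) (sym (Finₚ.toℕ-fromℕ< bound)))

      Cyclic : ℕ → Set
      Cyclic j = ¬ Sp (x + j) × fac (x + j) n ≡ fac (x + (suc d + j)) n

      -- The two claims need each other. Beyond the window, non-specialness at `j` comes from the
      -- equality of factors one period earlier; the equality at `suc j` comes from non-specialness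
      -- at `j`, which fixes the next letter.
      cyclic : ∀ j → Cyclic j
      cyclic = <-rec Cyclic step
        where
        step : ∀ j → (∀ {i} → i < j → Cyclic i) → Cyclic j
        step j below = nonspecial (<-≤-connex j (suc d)) , equal j below
          where
          nonspecial : j < suc d ⊎ suc d ≤ j → ¬ Sp (x + j)
          nonspecial (inj₁ j<) = window j j<
          nonspecial (inj₂ d<j) sp with m≤n⇒∃[o]m+o≡n d<j
          ... | o , refl with below {o} (m<n+m o z<s)
          ...   | ¬sp , eq = ¬sp (subst (Special u) (sym eq) sp)
          equal : ∀ j → (∀ {i} → i < j → Cyclic i) → fac (x + j) n ≡ fac (x + (suc d + j)) n
          equal zero    below = subst₂ (λ y z → fac y n ≡ fac (x + z) n) (sym (+-identityʳ x)) (sym (+-identityʳ (suc d))) returns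
          equal (suc j) below with below {j} (n<1+n j)
          ... | ¬sp , eq = subst₂ (λ y z → fac y n ≡ fac z n) (sym (+-suc x j))
                  (trans (sym (+-suc x (suc d + j))) (cong (x +_) (sym (+-suc (suc d) j))))
                  (fac-tail (¬Special-extend ¬sp eq))

      periodic : ∀ m → x + n ≤ m → u (m + suc d) ≡ u m
      periodic m x+n≤m with m≤n⇒∃[o]m+o≡n x+n≤m
      ... | j , refl = trans (cong u shift) (sym (trans (cong u start) (¬Special-next (proj₁ (cyclic j)) (proj₂ (cyclic j)))))
        where
        open import Data.Nat.Tactic.RingSolver using (solve-∀)
        start : x + n + j ≡ x + j + n
        start = lemma x n j
          where
          lemma : ∀ x n j → x + n + j ≡ x + j + n
          lemma = solve-∀
        shift : x + n + j + suc d ≡ x + (suc d + j) + n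
        shift = lemma x n j d
          where
          lemma : ∀ x n j d → x + n + j + suc d ≡ x + (suc d + j) + n
          lemma = solve-∀

    abstract
      special-ahead : ∀ i → ∃[ j ] i ≤ j × Sp j
      special-ahead = special-ahead′

    -- An edge of the reduced Rauzy graph, read in u: it leaves the special factor
    -- at i, enters the one at i + suc ℓ and meets no special factor in between.
    Red : ℕ → ℕ → Set
    Red i ℓ = Sp i × Sp (i + suc ℓ) × (∀ j → j < ℓ → ¬ Sp (i + suc j))

    red : ℕ → ℕ → Word k
    red i ℓ = fac i (suc ℓ + n)

    Edge : Word k → Set
    Edge p = ∃[ i ] ∃[ ℓ ] Red i ℓ × p ≡ red i ℓ

    abstract
      red-from : ∀ {i} → Sp i → ∃[ ℓ ] Red i ℓ
      red-from {i} sp with special-ahead (suc i)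
      ... | j , i<j , spj with m≤n⇒∃[o]m+o≡n i<j
      ...   | o , refl with leastℕ (λ d → Sp? (i + suc d)) (suc o)
      ...     | inj₁ (ℓ , _ , spℓ , min) = ℓ , sp , spℓ , min
      ...     | inj₂ none = ⊥-elim (none o (n<1+n o) (subst Sp (sym (+-suc i o)) spj))

    abstract
      -- The second alternative, that `m` is the first special position of `u`, will be the root of
      -- the spanning tree.
      red-to : ∀ {m} → Sp m → (∃[ i ] ∃[ ℓ ] i + suc ℓ ≡ m × Red i ℓ) ⊎ (∀ j → j < m → ¬ Sp j)
      red-to {m} sp with greatestBelow Sp? m
      ... | inj₂ none = inj₂ none
      ... | inj₁ (i , ℓ , refl , spi , between) = inj₁ (i , ℓ , refl , spi , sp ,
        λ j j<ℓ → between (i + suc j) (m<m+n i z<s) (+-monoʳ-< i (s<s j<ℓ)))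

    abstract
      containing-red : ∀ {e} → 𝓛ₙ u (suc n) e → ∃[ i ] ∃[ ℓ ] ∃[ j ] Red i ℓ × j ≤ ℓ × e ≡ fac (i + j) (suc n)
      containing-red {e} (e∈ , len) with special-ahead 0
      ... | i₁ , _ , sp₁ with recurs-after e∈ i₁
      -- The occurrence is taken after some special position, so that an edge has already begun
      -- there. The search runs below `suc x` because `x` itself may be special; then `e` is the
      -- first arrow of its edge.
      ...   | x , i₁≤x , occ with greatestBelow Sp? (suc x)
      ...     | inj₂ none = ⊥-elim (none i₁ (s≤s i₁≤x) sp₁)
      ...     | inj₁ (i , d , eq , spi , between) with red-from spi
      ...       | ℓ , r = i , ℓ , d , r , ≮⇒≥ (λ ℓ<d → between (i + suc ℓ) (m<m+n i z<s)
                    (subst (i + suc ℓ <_) eq (+-monoʳ-< i (s<s ℓ<d))) (proj₁ (proj₂ r))) ,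
                  trans (sym occ) (cong₂ fac (suc-injective (trans (sym eq) (+-suc i d))) len)

    -- After a non-special factor the next letter is forced, so two walks with the same first arrow
    -- stay together until a special factor is met.
    run : ∀ {i i′} m → (∀ j → j < m → ¬ Sp (i + suc j)) → fac i (suc n) ≡ fac i′ (suc n) →
      red i m ≡ red i′ m × fac (i + suc m) n ≡ fac (i′ + suc m) n
    run {i} {i′} m none eq = whole m none , last-part m (whole m none)
      where
      last-part : ∀ m → red i m ≡ red i′ m → fac (i + suc m) n ≡ fac (i′ + suc m) n
      last-part m e = proj₂ (++-split (fac i (suc m)) (fac i′ (suc m))
        (trans (length-factor u i (suc m)) (sym (length-factor u i′ (suc m))))
        (trans (sym (factor-+ u i (suc m) n)) (trans e (factor-+ u i′ (suc m) n))))
      whole : ∀ m → (∀ j → j < m → ¬ Sp (i + suc j)) → red i m ≡ red i′ m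
      whole zero    _    = eq
      whole (suc m) none = trans (factor-snoc u i (suc m + n)) (trans
        (cong₂ (λ w a → w ++ [ a ]) ih
          (trans (cong u (sym (+-assoc i (suc m) n)))
            (trans (¬Special-next (none m (n<1+n m)) (last-part m ih)) (cong u (+-assoc i′ (suc m) n)))))
        (sym (factor-snoc u i′ (suc m + n))))
        where
        ih = whole m (λ j j<m → none j (m<n⇒m<1+n j<m))

    -- If one edge were shorter, its special end would be an interior vertex of the other. Hence a
    -- reduced edge is determined by its first arrow, and edges can be counted by the arrows that
    -- leave special vertices.
    red-deterministic : ∀ {i ℓ i′ ℓ′} → Red i ℓ → Red i′ ℓ′ → fac i (suc n) ≡ fac i′ (suc n) → red i ℓ ≡ red i′ ℓ′
    red-deterministic {i} {ℓ} {i′} {ℓ′} (_ , sp , none) (_ , sp′ , none′) eq with <-cmp ℓ ℓ′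
    ... | tri≈ _ refl _ = proj₁ (run ℓ none eq)
    ... | tri< ℓ<ℓ′ _ _ = ⊥-elim (none′ ℓ ℓ<ℓ′ (subst (Special u) (proj₂ (run ℓ none eq)) sp))
    ... | tri> _ _ ℓ′<ℓ = ⊥-elim (none ℓ′ ℓ′<ℓ (subst (Special u) (proj₂ (run ℓ′ none′ (sym eq))) sp′))

    red-prefix : ∀ i ℓ → red i ℓ ≡ fac i (suc n) ++ fac (i + suc n) ℓ
    red-prefix i ℓ = trans (cong (fac i) (cong suc (+-comm ℓ n))) (factor-+ u i (suc n) ℓ)

    length-red : ∀ i ℓ → length (red i ℓ) ≡ suc ℓ + n
    length-red i ℓ = length-factor u i (suc ℓ + n)

    Edge-image : ∀ g {p} → Edge p → Edge (elem g p)
    Edge-image g {p} (i , ℓ , (sp , sp′ , none) , refl) with 𝓛⇒factor u (invariant g _ (factor∈𝓛 u i (suc ℓ + n)))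
    ... | i′ , eq₀ = i′ , ℓ , image (inAM g) , eq
      where
      eq : elem g (red i ℓ) ≡ red i′ ℓ
      eq = trans eq₀ (cong (fac i′) (trans (length-elem g (red i ℓ)) (length-red i ℓ)))

      lengths : ∀ j j′ → j + j′ ≡ suc ℓ → suc ℓ + n ≡ j + (n + j′)
      lengths j j′ e = trans (cong (_+ n) (sym e)) (trans (+-assoc j j′ n) (cong (j +_) (+-comm j′ n)))

      image : Morphism (elem g) ⊎ Antimorphism (elem g) → Red i′ ℓ
      image (inj₁ m) = subst Sp (+-identityʳ i′) (subst (Special u) (sym (at 0 (suc ℓ) refl))
                         (Special-image u invariant g (subst Sp (sym (+-identityʳ i)) sp))) ,
                       subst (Special u) (sym (at (suc ℓ) 0 (+-identityʳ (suc ℓ)))) (Special-image u invariant g sp′) ,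
                       λ j j<ℓ spj → none j j<ℓ (Special-preimage u invariant g
                         (subst (Special u) (at (suc j) (ℓ ∸ j) (cong suc (m+[n∸m]≡n (<⇒≤ j<ℓ)))) spj))
        where
        at : ∀ j j′ → j + j′ ≡ suc ℓ → fac (i′ + j) n ≡ elem g (fac (i + j) n)
        at j j′ e = image-factor-morphism u g j m (lengths j j′ e) eq
      image (inj₂ m) = subst Sp (+-identityʳ i′) (subst (Special u) (sym (at (suc ℓ) 0 (+-identityʳ (suc ℓ))))
                         (Special-image u invariant g sp′)) ,
                       subst (Special u) (sym (at 0 (suc ℓ) refl))
                         (Special-image u invariant g (subst Sp (sym (+-identityʳ i)) sp)) ,
                       -- Reflection of the interior: offset `suc j` in the image comes from offset
                       -- `suc o`, where `suc o` and `suc j` add up to `suc ℓ`.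
                       λ j j<ℓ spj → let o , o+ = m≤n⇒∃[o]m+o≡n j<ℓ in
                         none o (subst (suc o ≤_) (trans (sym (+-suc o j)) (trans (+-comm o (suc j)) o+)) (s≤s (m≤m+n o j)))
                           (Special-preimage u invariant g (subst (Special u)
                             (at (suc o) (suc j) (cong suc (trans (+-suc o j) (trans (cong suc (+-comm o j)) o+)))) spj))
        where
        at : ∀ j j′ → j + j′ ≡ suc ℓ → fac (i′ + j′) n ≡ elem g (fac (i + j) n)
        at j j′ e = image-factor-antimorphism u g j m (lengths j j′ e) eq

    ¬Special-left : ∀ {w a} → ¬ Special u w → 𝓛 u (a ∷ w) → ∀ c → 𝓛 u (c ∷ w) → c ≡ a
    ¬Special-left {w} {a} ¬sp aw c cw with c Finₚ.≟ a
    ... | yes c≡a = c≡a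
    ... | no  c≢a = ⊥-elim (¬sp (inj₁ (c , a , c≢a , cw , aw)))

    module _ {w : Word k} {b : Fin k} (¬sp : ¬ Special u w) (wb : 𝓛 u (w ++ [ b ])) where
      private
        b′ = length-1 (elem θ [ b ]) (length-elem θ [ b ])
        θ-image : elem θ (w ++ [ b ]) ≡ proj₁ b′ ∷ elem θ w
        θ-image = trans (θ-anti w [ b ]) (cong (_++ elem θ w) (proj₂ b′))
        unique : ∀ c → 𝓛 u (c ∷ elem θ w) → c ≡ proj₁ b′
        unique = ¬Special-left (¬sp ∘ Special-preimage u invariant θ) (subst (𝓛 u) θ-image (invariant θ _ wb))

      -- A unique right extension is turned into a unique left extension by the antimorphism `θ`,
      -- which preserves frequencies; so the count on the left suffices.
      HasFrequency-∷ʳ⁻ : ∀ {ρ} → HasFrequency u (w ++ [ b ]) ρ → HasFrequency u w ρ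
      HasFrequency-∷ʳ⁻ {ρ} f = HasFrequency-elem⁻ u G invariant θ
        (HasFrequency-∷⁻ u unique (subst (λ x → HasFrequency u x ρ) θ-image (HasFrequency-elem u G invariant θ f)))

    module _ {i : ℕ} {ρ : ℝ} (¬sp : ¬ Sp (suc i)) where
      private
        first : ∀ c → 𝓛 u (c ∷ fac (suc i) n) → c ≡ u i
        first = ¬Special-left ¬sp (subst (𝓛 u) (factor-cons u i n) (factor∈𝓛 u i (suc n)))
        last : 𝓛 u (fac (suc i) n ++ [ u (suc i + n) ])
        last = subst (𝓛 u) (factor-snoc u (suc i) n) (factor∈𝓛 u (suc i) (suc n))

      -- The arrows entering and leaving a non-special vertex both have the frequency of that
      -- vertex.
      HasFrequency-previous : HasFrequency u (fac (suc i) (suc n)) ρ → HasFrequency u (fac i (suc n)) ρ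
      HasFrequency-previous f = subst (λ x → HasFrequency u x ρ) (sym (factor-cons u i n))
        (HasFrequency-∷⁺ u first (HasFrequency-∷ʳ⁻ ¬sp last (subst (λ x → HasFrequency u x ρ) (factor-snoc u (suc i) n) f)))

    HasFrequency-along⁻ : ∀ {i ℓ ρ} → Red i ℓ → ∀ j → j ≤ ℓ →
      HasFrequency u (fac (i + j) (suc n)) ρ → HasFrequency u (fac i (suc n)) ρ
    HasFrequency-along⁻ {i} {ρ = ρ} r zero    _   f = subst (λ x → HasFrequency u (fac x (suc n)) ρ) (+-identityʳ i) f
    HasFrequency-along⁻ {i} {ρ = ρ} r (suc j) j<ℓ f = HasFrequency-along⁻ r j (<⇒≤ j<ℓ)
      (HasFrequency-previous (λ sp → proj₂ (proj₂ r) j j<ℓ (subst Sp (sym (+-suc i j)) sp))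
        (subst (λ x → HasFrequency u (fac x (suc n)) ρ) (+-suc i j) f))

    abstract
      distinct-letters : ∃[ a ] ∃[ b ] _≢_ {A = Fin k} a b
      distinct-letters with special-ahead 0
      ... | _ , _ , inj₁ (a , b , a≢b , _) = a , b , a≢b
      ... | _ , _ , inj₂ (a , b , a≢b , _) = a , b , a≢b

    abstract
      -- Being an antimorphism is a statement about all words. It is decidable here because `inAM`
      -- names a kind, and two distinct letters exclude that a morphism is also an antimorphism.
      GPalindrome? : Decidable (GPalindrome G)
      GPalindrome? w = Finₚ.any? λ i → anti? i ×-dec (elem i w ≟ w)
        where
        anti? : ∀ i → Dec (Antimorphism (elem i))
        anti? i with inAM i
        ... | inj₁ m = no (¬morphism×antimorphism (proj₂ (proj₂ distinct-letters)) i m)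
        ... | inj₂ a = yes a

    -- In the Rauzy graph, `take n e` is the vertex that the arrow `e` leaves.
    StartSpecial : Word k → Set
    StartSpecial e = length (take n e) ≡ n × Special u (take n e)

    StartSpecial? : Decidable StartSpecial
    StartSpecial? e = withLength? Special? (take n e)

    starts : List (Word k)
    starts = filter StartSpecial? arrows

    take-fac : ∀ i → take n (fac i (suc n)) ≡ fac i n
    take-fac i = trans (cong (take n) (factor-snoc u i n)) (take-++-length (fac i n) n (length-factor u i n))

    take-red : ∀ i ℓ → take (suc n) (red i ℓ) ≡ fac i (suc n)
    take-red i ℓ = trans (cong (take (suc n)) (red-prefix i ℓ)) (take-++-length (fac i (suc n)) (suc n) (length-factor u i (suc n)))

    start⇒Edge : ∀ {s} → s ∈ starts → ∃[ p ] Edge p × take (suc n) p ≡ s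
    start⇒Edge {s} s∈ with ∈-filter⁻ StartSpecial? {xs = arrows} s∈
    ... | s∈arrows , _ , sp with Equivalence.to (arrows-spec s) s∈arrows
    ...   | (i , occ) , len with trans (sym occ) (cong (fac i) len)
    ...     | refl with red-from (subst (Special u) (take-fac i) sp)
    ...       | ℓ , r = red i ℓ , (i , ℓ , r , refl) , take-red i ℓ

    abstract
      -- One reduced edge is chosen for each arrow that leaves a special vertex. The list is
      -- complete because an edge is determined by its first arrow, and its length is the number of
      -- these arrows.
      edge-preimages : ∃[ ys ] map (take (suc n)) ys ≡ starts × All Edge ys
      edge-preimages = preimages (take (suc n)) (All.tabulate start⇒Edge)

    edges : List (Word k)
    edges = proj₁ edge-preimages

    map-take-edges : map (take (suc n)) edges ≡ starts
    map-take-edges = proj₁ (proj₂ edge-preimages)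

    edges-unique : Unique edges
    edges-unique = Uniqueₚ.map⁻ (subst Unique (sym map-take-edges) (Uniqueₚ.filter⁺ StartSpecial? arrows-unique))

    ∈-edges⁻ : ∀ {p} → p ∈ edges → Edge p
    ∈-edges⁻ = All.lookup (proj₂ (proj₂ edge-preimages))

    ∈-edges⁺ : ∀ {p} → Edge p → p ∈ edges
    ∈-edges⁺ (i , ℓ , r , refl) with ∈-map⁻ (take (suc n)) (subst (take (suc n) (red i ℓ) ∈_) (sym map-take-edges)
      (subst (_∈ starts) (sym (take-red i ℓ)) (∈-filter⁺ StartSpecial? (∈-arrows (factor∈𝓛 u i (suc n)) (length-factor u i (suc n)))
        (trans (cong length (take-fac i)) (length-factor u i n) , subst (Special u) (sym (take-fac i)) (proj₁ r)))))
    ... | p′ , p′∈ , eq with ∈-edges⁻ p′∈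
    ...   | i′ , ℓ′ , r′ , refl = subst (_∈ edges) (sym (red-deterministic r r′
            (trans (sym (take-red i ℓ)) (trans eq (take-red i′ ℓ′))))) p′∈

    palindromicEdges : List (Word k)
    palindromicEdges = filter GPalindrome? edges

    specials : List (Word k)
    specials = filter (withLength? Special?) vertices

    ∈-specials⁻ : ∀ {w} → w ∈ specials → 𝓛 u w × length w ≡ n × Special u w
    ∈-specials⁻ {w} w∈ with ∈-filter⁻ (withLength? Special?) {xs = vertices} w∈
    ... | w∈vertices , len , sp = proj₁ (Equivalence.to (vertices-spec w) w∈vertices) , len , sp

    red-letters : ∀ i ℓ → AllLetters (red i ℓ)
    red-letters i ℓ = subst AllLetters (sym (trans (cong (fac i) (+-comm (suc ℓ) n)) (factor-+ u i n (suc ℓ))))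
      (AllLetters-++ [] (fac i n) _ (letters i))

    -- At most two elements carry `w` to `x`. If `g` and `h` were different, the smaller element
    -- belonging to each would have to be the other one.
    NonLeast-unique : ∀ {w x} → AllLetters w → ∀ {g h} →
      NonLeast (λ f → elem f w ≡ x) g → NonLeast (λ f → elem f w ≡ x) h → g ≡ h
    NonLeast-unique all {g} {h} (eg , g′ , g′<g , eg′) (eh , h′ , h′<h , eh′) with g Finₚ.≟ h
    ... | yes g≡h = g≡h
    ... | no  g≢h = ⊥-elim (<-asym (subst (Fin._< g) g′≡h g′<g) (subst (Fin._< h) h′≡g h′<h))
      where
      g′≡h : g′ ≡ h
      g′≡h = at-most-two all (λ { refl → <-irrefl refl g′<g }) g≢h (trans eg′ (sym eg)) (trans eg (sym eh))
      h′≡g : h′ ≡ g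
      h′≡g = at-most-two all (λ { refl → <-irrefl refl h′<h }) (g≢h ∘ sym) (trans eh′ (sym eh)) (trans eh (sym eg))

    -- Frequencies against orbits of reduced edges

    module _ {m : ℕ} (ρ : Fin m → ℝ) (ρ-distinct : ∀ i j → i ≢ j → ¬ ρ i ≃ ρ j)
      (ρ-frequency : ∀ i → ∃[ e ] 𝓛ₙ u (suc n) e × HasFrequency u e (ρ i)) where
      private
        abstract
          located : ∀ f → ∃[ i ] ∃[ ℓ ] ∃[ j ] Red i ℓ × j ≤ ℓ × HasFrequency u (fac (i + j) (suc n)) (ρ f)
          located f with ρ-frequency f
          ... | e , e∈ , freq with containing-red e∈
          ...   | i , ℓ , j , r , j≤ℓ , refl = i , ℓ , j , r , j≤ℓ , freq

        path : Fin m → Word k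
        path f = red (proj₁ (located f)) (proj₁ (proj₂ (located f)))

        path-Edge : ∀ f → Edge (path f)
        path-Edge f with located f
        ... | i , ℓ , _ , r , _ = i , ℓ , r , refl

        path-letters : ∀ f → AllLetters (path f)
        path-letters f = red-letters _ _

        -- The arrow representing `ρ f` is carried to an arrow of `path f′`. There it is moved back
        -- to the first arrow, as is the one representing `ρ f′`, and uniqueness of the frequency
        -- applies.
        same-frequency : ∀ {f f′ h} → elem h (path f) ≡ path f′ → ρ f ≃ ρ f′
        same-frequency {f} {f′} {h} eq with located f | located f′
        ... | i , ℓ , j , r , j≤ℓ , freq | i′ , ℓ′ , j′ , r′ , j′≤ℓ′ , freq′ = go sameLength eq freq
          where
          sameLength : ℓ ≡ ℓ′
          sameLength = suc-injective (+-cancelʳ-≡ n (suc ℓ) (suc ℓ′)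
            (trans (sym (length-red i ℓ)) (trans (sym (length-elem h (red i ℓ))) (trans (cong length eq) (length-red i′ ℓ′)))))
          starting : ∀ {x ρ} → x ≤ ℓ′ → HasFrequency u (fac (i′ + x) (suc n)) ρ → HasFrequency u (fac i′ (suc n)) ρ
          starting {x} = HasFrequency-along⁻ r′ x
          split : suc ℓ + n ≡ j + (suc n + (ℓ ∸ j))
          split = begin
            suc ℓ + n               ≡⟨ cong (λ x → suc x + n) (m+[n∸m]≡n j≤ℓ) ⟨
            suc (j + (ℓ ∸ j)) + n   ≡⟨ lemma j (ℓ ∸ j) n ⟩
            j + (suc n + (ℓ ∸ j))   ∎
            where
            open ≡-Reasoning
            open import Data.Nat.Tactic.RingSolver using (solve-∀)
            lemma : ∀ j d n → suc (j + d) + n ≡ j + (suc n + d)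
            lemma = solve-∀
          image : Morphism (elem h) ⊎ Antimorphism (elem h) → elem h (red i ℓ) ≡ red i′ ℓ →
            ∃[ x ] x ≤ ℓ × fac (i′ + x) (suc n) ≡ elem h (fac (i + j) (suc n))
          image (inj₁ mo) e = j , j≤ℓ , image-factor-morphism u h j mo split e
          -- An antimorphism reverses the `suc ℓ` arrows of the edge, so offset `j` becomes `ℓ ∸ j`.
          image (inj₂ an) e = ℓ ∸ j , m∸n≤m ℓ j , image-factor-antimorphism u h j an split e
          go : ℓ ≡ ℓ′ → elem h (red i ℓ) ≡ red i′ ℓ′ → HasFrequency u (fac (i + j) (suc n)) (ρ f) → ρ f ≃ ρ f′
          go refl e freq with image (inAM h) e
          ... | x , x≤ , ex = HasFrequency-unique u
            (starting x≤ (subst (λ w → HasFrequency u w (ρ f)) (sym ex) (HasFrequency-elem u G invariant h freq)))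
            (starting j′≤ℓ′ freq′)

        -- Different frequencies have disjoint orbits of paths. The case distinction is made on
        -- indices, where equality is decidable, and this is why the frequencies form an indexed
        -- family.
        path-separates : ∀ {f f′ g g′} → elem g (path f) ≡ elem g′ (path f′) → f ≡ f′
        path-separates {f} {f′} {g} {g′} eq with f Finₚ.≟ f′
        ... | yes f≡f′ = f≡f′
        ... | no  f≢f′ = ⊥-elim (ρ-distinct f f′ f≢f′ (same-frequency {h = proj₁ (transport g g′ eq)} (proj₂ (transport g g′ eq))))

        -- A palindromic edge is the image of a given path under exactly two elements
        -- of G, any other edge under at most one.
        R : Fin order × Fin m → Word k ⊎ Word k → Set
        R (g , f) (inj₁ e) = Least (λ h → elem h (path f) ≡ e) g
        R (g , f) (inj₂ e) = NonLeast (λ h → elem h (path f) ≡ e) g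

        total : ∀ gf → ∃[ e ] e ∈ edges ⊕ palindromicEdges × R gf e
        total (g , f) with Finₚ.any? (λ h → (h Finₚ.<? g) ×-dec (elem h (path f) ≟ elem g (path f)))
        ... | no  none = inj₁ e , ∈-⊕ˡ (∈-edges⁺ (Edge-image g (path-Edge f))) , refl , λ h h<g eq → none (h , h<g , eq)
          where e = elem g (path f)
        ... | yes (h , h<g , eq) = inj₂ e , ∈-⊕ʳ edges (∈-filter⁺ GPalindrome? (∈-edges⁺ (Edge-image g (path-Edge f)))
                (stabilised⇒palindrome (path-letters f) {g} {h} (λ { refl → <-irrefl refl h<g }) (sym eq))) ,
                refl , h , h<g , eq
          where e = elem g (path f)

        injective : ∀ {x x′ e} → R x e → R x′ e → x ≡ x′
        injective {g , f} {g′ , f′} {inj₁ e} l l′ with path-separates {f} {f′} {g} {g′} (trans (proj₁ l) (sym (proj₁ l′)))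
        ... | refl = cong (_, f) (Least-unique l l′)
        injective {g , f} {g′ , f′} {inj₂ e} l l′ with path-separates {f} {f′} {g} {g′} (trans (proj₁ l) (sym (proj₁ l′)))
        ... | refl = cong (_, f) (NonLeast-unique (path-letters f) l l′)

      frequencies-bound : order * m ≤ length edges + length palindromicEdges
      frequencies-bound = subst₂ _≤_ (length-tabulate id) (length-⊕ edges palindromicEdges)
        (length-≤ {xs = allFin (order * m)} (λ x → R (remQuot m x)) (Uniqueₚ.allFin⁺ (order * m)) (λ {x} _ → total (remQuot m x)) separated)
        where
        separated : ∀ {x x′ e} → R (remQuot m x) e → R (remQuot {order} m x′) e → x ≡ x′
        separated {x} {x′} r r′ = trans (sym (Finₚ.combine-remQuot {order} m x))
          (trans (cong (λ gf → combine (proj₁ gf) (proj₂ gf)) (injective r r′)) (Finₚ.combine-remQuot {order} m x′))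

    -- u visits the G-orbit of the factor at i for the first time at i.  The edge
    -- entering that factor then comes from an orbit visited earlier, so these edges
    -- form a spanning tree of the graph of orbits.
    First : ℕ → Set
    First i = ∀ j → j < i → ∀ g → elem g (fac j n) ≢ fac i n

    First-≤ : ∀ {i j} → First i → ∀ g h → elem g (fac i n) ≡ elem h (fac j n) → i ≤ j
    First-≤ {i} {j} first g h eq = ≮⇒≥ λ j<i → let f , ef = transport h g (sym eq) in first j j<i f ef

    private
      red-ends : ∀ i ℓ → red i ℓ ≡ fac i n ++ fac (i + n) (suc ℓ) × red i ℓ ≡ fac i (suc ℓ) ++ fac (i + suc ℓ) n
      red-ends i ℓ = trans (cong (fac i) (+-comm (suc ℓ) n)) (factor-+ u i n (suc ℓ)) , factor-+ u i (suc ℓ) n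

      same-length : ∀ g h i j → length (elem g (fac i n)) ≡ length (elem h (fac j n))
      same-length g h i j = trans (trans (length-elem g _) (length-factor u i n)) (sym (trans (length-elem h _) (length-factor u j n)))

      module _ {g : Fin order} {i ℓ : ℕ} where
        morphism-ends : Morphism (elem g) →
          elem g (red i ℓ) ≡ elem g (fac i n) ++ elem g (fac (i + n) (suc ℓ)) ×
          elem g (red i ℓ) ≡ elem g (fac i (suc ℓ)) ++ elem g (fac (i + suc ℓ) n)
        morphism-ends m = trans (cong (elem g) (proj₁ (red-ends i ℓ))) (m _ _) , trans (cong (elem g) (proj₂ (red-ends i ℓ))) (m _ _)

        antimorphism-ends : Antimorphism (elem g) →
          elem g (red i ℓ) ≡ elem g (fac (i + suc ℓ) n) ++ elem g (fac i (suc ℓ)) ×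
          elem g (red i ℓ) ≡ elem g (fac (i + n) (suc ℓ)) ++ elem g (fac i n)
        antimorphism-ends m = trans (cong (elem g) (proj₂ (red-ends i ℓ))) (m _ _) , trans (cong (elem g) (proj₁ (red-ends i ℓ))) (m _ _)

      prefixes-≡ : ∀ g h i j {x y} → elem g (fac i n) ++ x ≡ elem h (fac j n) ++ y → elem g (fac i n) ≡ elem h (fac j n)
      prefixes-≡ g h i j eq = proj₁ (++-split (elem g (fac i n)) (elem h (fac j n)) (same-length g h i j) eq)

      suffixes-≡ : ∀ g h i j x y → x ++ elem g (fac i n) ≡ y ++ elem h (fac j n) → elem g (fac i n) ≡ elem h (fac j n)
      suffixes-≡ g h i j x y eq = ++-splitʳ x y (same-length g h i j) eq

      Collision : (g h : Fin order) (i ℓ i′ ℓ′ : ℕ) → Set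
      Collision g h i ℓ i′ ℓ′ = First (i + suc ℓ) × First (i′ + suc ℓ′) × elem g (red i ℓ) ≡ elem h (red i′ ℓ′)

      -- Maps of opposite kinds match the end of each edge with the start of the other, up to the
      -- group. Since each end is a first visit, each edge would have to end no later than the other
      -- begins.
      morphism-antimorphism : ∀ {g h i ℓ i′ ℓ′} → Collision g h i ℓ i′ ℓ′ → Morphism (elem g) → Antimorphism (elem h) → ⊥
      morphism-antimorphism {g} {h} {i} {ℓ} {i′} {ℓ′} (first , first′ , eq) m a = <-irrefl refl (begin-strict
        i            <⟨ m<m+n i z<s ⟩
        i + suc ℓ    ≤⟨ First-≤ first g h (suffixes-≡ g h (i + suc ℓ) i′ _ _
                         (trans (sym (proj₂ (morphism-ends m))) (trans eq (proj₂ (antimorphism-ends a))))) ⟩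
        i′           <⟨ m<m+n i′ z<s ⟩
        i′ + suc ℓ′  ≤⟨ First-≤ first′ h g (prefixes-≡ h g (i′ + suc ℓ′) i
                         (trans (sym (proj₁ (antimorphism-ends a))) (trans (sym eq) (proj₁ (morphism-ends m))))) ⟩
        i            ∎)
        where open ≤-Reasoning

      opposite-collision : ∀ {g h i ℓ i′ ℓ′} → Collision g h i ℓ i′ ℓ′ → OppositeKind (elem g) (elem h) → ⊥
      opposite-collision c              (inj₁ (m , a)) = morphism-antimorphism c m a
      opposite-collision (f , f′ , eq) (inj₂ (a , m)) = morphism-antimorphism (f′ , f , sym eq) m a

      same-ends : ∀ {g h i ℓ i′ ℓ′} → Collision g h i ℓ i′ ℓ′ → SameKind (elem g) (elem h) →
        elem g (fac (i + suc ℓ) n) ≡ elem h (fac (i′ + suc ℓ′) n)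
      same-ends {g} {h} {i} {ℓ} {i′} {ℓ′} (_ , _ , eq) (inj₁ (m , m′)) = suffixes-≡ g h (i + suc ℓ) (i′ + suc ℓ′) _ _
        (trans (sym (proj₂ (morphism-ends m))) (trans eq (proj₂ (morphism-ends m′))))
      same-ends {g} {h} {i} {ℓ} {i′} {ℓ′} (_ , _ , eq) (inj₂ (a , a′)) = prefixes-≡ g h (i + suc ℓ) (i′ + suc ℓ′)
        (trans (sym (proj₁ (antimorphism-ends a))) (trans eq (proj₁ (antimorphism-ends a′))))

      -- Maps of the same kind match end with end. Both ends are first visits to the same orbit,
      -- hence the same position, and there the word with all letters identifies `g` with `h`.
      collision : ∀ {g h i ℓ i′ ℓ′} → Collision g h i ℓ i′ ℓ′ → g ≡ h × i + suc ℓ ≡ i′ + suc ℓ′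
      collision {g} {h} {i} {ℓ} {i′} {ℓ′} c@(first , first′ , _) with kind-cmp g h
      ... | inj₂ opp  = ⊥-elim (opposite-collision c opp)
      ... | inj₁ same = same-kind-≡ (letters (i + suc ℓ)) g h same
            (trans (same-ends c same) (cong (λ x → elem h (fac x n)) (sym ends))) , ends
        where
        ends : i + suc ℓ ≡ i′ + suc ℓ′
        ends = ≤-antisym (First-≤ first g h (same-ends c same)) (First-≤ first′ h g (sym (same-ends c same)))

    -- Special factors and palindromes against the edges of the spanning tree

    module _ (palindromes : List (Word k)) (palindromes-unique : Unique palindromes)
      (∈-palindromes : ∀ {y} → y ∈ palindromes → 𝓛 u y × length y ≡ n × Special u y × GPalindrome G y) where
      private
        -- Codes a special factor by the first visit `i` to its orbit and an element `t` that
        -- carries the factor found there to it. A palindrome has two such elements, and its second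
        -- listing takes the larger one.
        Token : Word k ⊎ Word k → Fin order → ℕ → Set
        Token (inj₁ v) t i = Least (λ h → elem h (fac i n) ≡ v) t
        Token (inj₂ y) t i = NonLeast (λ h → elem h (fac i n) ≡ y) t

        Token-injective : ∀ {x x′ t i} → Token x t i → Token x′ t i → x ≡ x′
        Token-injective {inj₁ v} {inj₁ _} (e , _) (e′ , _) = cong inj₁ (trans (sym e) e′)
        Token-injective {inj₂ y} {inj₂ _} (e , _) (e′ , _) = cong inj₂ (trans (sym e) e′)
        Token-injective {inj₁ v} {inj₂ y} l@(e , _) l′@(e′ , _) with trans (sym e) e′
        ... | refl = ⊥-elim (¬Least×NonLeast l l′)
        Token-injective {inj₂ y} {inj₁ v} l′@(e , _) l@(e′ , _) with trans (sym e) e′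
        ... | refl = ⊥-elim (¬Least×NonLeast l l′)

        -- Tokens of the root orbit are sent to their group element. Any other token is sent to the
        -- image under `t` of the edge by which `u` enters the factor at its position, and
        -- palindromic edges are sent to themselves.
        R : (Word k ⊎ Word k) ⊎ Word k → Fin order ⊎ Word k → Set
        R (inj₁ x) (inj₁ t) = ∃[ i ] Sp i × (∀ j → j < i → ¬ Sp j) × Token x t i
        R (inj₁ x) (inj₂ e) = ∃[ t ] ∃[ i ] ∃[ ℓ ] First (i + suc ℓ) × Token x t (i + suc ℓ) × elem t (red i ℓ) ≡ e
        R (inj₂ p) (inj₁ t) = ⊥
        R (inj₂ p) (inj₂ e) = GPalindrome G e × p ≡ e

        -- If an antimorphism `g` fixed the image under `t` of a tree edge, then `t` and its
        -- composite with `g` would be maps of opposite kinds that collide on this edge.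
        ¬palindrome : ∀ {t i ℓ} → First (i + suc ℓ) → ¬ GPalindrome G (elem t (red i ℓ))
        ¬palindrome {t} {i} {ℓ} first (g , anti , fixed) = opposite-collision
          (first , first , trans (proj₂ (composite g t) (red i ℓ)) fixed) (compose-anti g t anti)

        injective : ∀ {x x′ y} → R x y → R x′ y → x ≡ x′
        injective {inj₁ x} {inj₁ x′} {inj₁ t} (i , sp , none , tok) (i′ , sp′ , none′ , tok′) with <-cmp i i′
        ... | tri< i<i′ _ _ = ⊥-elim (none′ i i<i′ sp)
        ... | tri≈ _ refl _ = cong inj₁ (Token-injective tok tok′)
        ... | tri> _ _ i′<i = ⊥-elim (none i′ i′<i sp′)
        injective {inj₁ x} {inj₁ x′} {inj₂ e} (t , i , ℓ , first , tok , eq) (t′ , i′ , ℓ′ , first′ , tok′ , eq′)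
          with collision {t} {t′} {i} {ℓ} {i′} {ℓ′} (first , first′ , trans eq (sym eq′))
        ... | refl , ends = cong inj₁ (Token-injective tok (subst (Token x′ t) (sym ends) tok′))
        injective {inj₁ x} {inj₂ p} {inj₂ e} (t , i , ℓ , first , _ , refl) (pal , _) = ⊥-elim (¬palindrome {t} first pal)
        injective {inj₂ p} {inj₁ x} {inj₂ e} (pal , _) (t , i , ℓ , first , _ , refl) = ⊥-elim (¬palindrome {t} first pal)
        injective {inj₂ p} {inj₂ q} {inj₂ e} (_ , p≡e) (_ , q≡e) = cong inj₂ (trans p≡e (sym q≡e))

        first-visit : ∀ {v} → 𝓛 u v → length v ≡ n → ∃[ i ] First i × ∃[ t ] elem t (fac i n) ≡ v
        first-visit {v} (i₀ , occ) len with leastℕ (λ i → Finₚ.any? (λ t → elem t (fac i n) ≟ v)) (suc i₀)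
        ... | inj₂ none = ⊥-elim (none i₀ (n<1+n i₀) (proj₁ identity , trans (proj₂ identity _) (trans (cong (fac i₀) (sym len)) occ)))
        ... | inj₁ (i , _ , (t , et) , min) = i , first , t , et
          where
          first : First i
          first j j<i g eq = min j j<i (proj₁ (composite t g) , trans (proj₂ (composite t g) _) (trans (cong (elem t) eq) et))

        place : ∀ {x v i t} → Special u v → First i → elem t (fac i n) ≡ v → (∃[ t′ ] Token x t′ i) →
          ∃[ y ] y ∈ allFin order ⊕ edges × R (inj₁ x) y
        place {i = i} {t} sp first refl (t′ , tok) with red-to (Special-preimage u invariant t sp)
        ... | inj₂ none = inj₁ t′ , ∈-⊕ˡ (∈-allFin t′) , i , Special-preimage u invariant t sp , none , tok
        ... | inj₁ (i′ , ℓ , refl , r) = inj₂ (elem t′ (red i′ ℓ)) ,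
          ∈-⊕ʳ (allFin order) (∈-edges⁺ (Edge-image t′ (i′ , ℓ , r , refl))) , t′ , i′ , ℓ , first , tok , refl

        total : ∀ {x} → x ∈ (specials ⊕ palindromes) ⊕ palindromicEdges → ∃[ y ] y ∈ allFin order ⊕ edges × R x y
        total x∈ with ∈-⊕⁻ (specials ⊕ palindromes) x∈
        ... | inj₂ (p , p∈ , refl) with ∈-filter⁻ GPalindrome? {xs = edges} p∈
        ...   | p∈edges , pal = inj₂ p , ∈-⊕ʳ (allFin order) p∈edges , pal , refl
        total x∈ | inj₁ (z , z∈ , refl) with ∈-⊕⁻ specials z∈
        ... | inj₁ (v , v∈ , refl) with ∈-specials⁻ v∈
        ...   | occ , len , sp with first-visit occ len
        ...     | i , first , t , et = place {inj₁ v} {t = t} sp first et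
          (least {P = λ h → elem h (fac i n) ≡ v} (λ h → elem h (fac i n) ≟ v) et)
        total x∈ | inj₁ (z , z∈ , refl) | inj₂ (y , y∈ , refl) with ∈-palindromes y∈
        ... | occ , len , sp , g , anti , fixed with first-visit occ len
        ...   | i , first , t , et = place {inj₂ y} {t = t} sp first et
          -- The antimorphism `g` fixes `y`, so both `t` and its composite with `g` lead to `y`;
          -- their kinds are opposite, hence they are different indices.
          (nonLeast {P = λ h → elem h (fac i n) ≡ y} {proj₁ (composite g t)} {t}
            (opposite⇒≢ (proj₂ (proj₂ distinct-letters)) (compose-anti g t anti))
            (trans (proj₂ (composite g t) _) (trans (cong (elem g) et) fixed)) et)

      palindromes-bound : length specials + length palindromes + length palindromicEdges ≤ order + length edges
      palindromes-bound = subst₂ _≤_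
        (trans (length-⊕ (specials ⊕ palindromes) palindromicEdges) (cong (_+ length palindromicEdges) (length-⊕ specials palindromes)))
        (trans (length-⊕ (allFin order) edges) (cong (_+ length edges) (length-tabulate id)))
        (length-≤ R (⊕-unique (⊕-unique (Uniqueₚ.filter⁺ (withLength? Special?) vertices-unique) palindromes-unique)
          (Uniqueₚ.filter⁺ GPalindrome? edges-unique)) total injective)

    -- The edges are as many as the arrows leaving special vertices, and each non-special vertex is
    -- left by at least one of the remaining arrows.
    edges-bound : length edges + length vertices ≤ length arrows + length specials
    edges-bound = subst (λ x → x + length vertices ≤ length arrows + length specials)
      (trans (cong length (sym map-take-edges)) (length-map _ edges))
      (begin
        length starts + length vertices                           ≡⟨ cong (length starts +_) (length-filter-∁ (withLength? Special?) vertices) ⟨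
        length starts + (length specials + length nonspecial)     ≤⟨ +-monoʳ-≤ (length starts) (+-monoʳ-≤ (length specials) nonspecial-≤) ⟩
        length starts + (length specials + length nonstarts)      ≡⟨ cong (length starts +_) (+-comm (length specials) (length nonstarts)) ⟩
        length starts + (length nonstarts + length specials)      ≡⟨ +-assoc (length starts) (length nonstarts) (length specials) ⟨
        length starts + length nonstarts + length specials        ≡⟨ cong (_+ length specials) (length-filter-∁ StartSpecial? arrows) ⟩
        length arrows + length specials                           ∎)
      where
      open ≤-Reasoning
      nonspecial = filter (∁? (withLength? Special?)) vertices
      nonstarts = filter (∁? StartSpecial?) arrows

      total : ∀ {w} → w ∈ nonspecial → ∃[ e ] e ∈ nonstarts × take n e ≡ w
      total {w} w∈ with ∈-filter⁻ (∁? (withLength? Special?)) {xs = vertices} w∈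
      ... | w∈vertices , ¬sp with Equivalence.to (vertices-spec w) w∈vertices
      ...   | (i , occ) , len = fac i (suc n) ,
        ∈-filter⁺ (∁? StartSpecial?) (∈-arrows (factor∈𝓛 u i (suc n)) (length-factor u i (suc n)))
          (λ sp → ¬sp (subst (λ v → length v ≡ n × Special u v) prefix sp)) , prefix
        where
        prefix : take n (fac i (suc n)) ≡ w
        prefix = trans (take-fac i) (trans (cong (fac i) (sym len)) occ)

      nonspecial-≤ : length nonspecial ≤ length nonstarts
      nonspecial-≤ = length-≤ (λ w e → take n e ≡ w) (Uniqueₚ.filter⁺ (∁? (withLength? Special?)) vertices-unique)
        total (λ p q → trans (sym p) q)

    module _ (_▷_ : Word k → Fin k → Word k)
      (▷-injective : ∀ w w′ {a a′} → w ▷ a ≡ w′ ▷ a′ → w ≡ w′ × a ≡ a′)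
      (▷-length : ∀ w {a} → length w ≡ n → length (w ▷ a) ≡ suc n)
      (extensible : ∀ {w} → 𝓛ₙ u n w → ∃[ a ] 𝓛 u (w ▷ a))
      (special? : ∀ w → length w ≡ n → Dec (∃[ a ] ∃[ b ] a ≢ b × 𝓛 u (w ▷ a) × 𝓛 u (w ▷ b))) where

      -- Every vertex uses its least extending letter and every branching vertex one more. The
      -- operation `_▷_` stands for adding a letter on either side, so one proof serves right and
      -- left special factors.
      extensions-bound : length vertices + length (filter (withLength? special?) vertices) ≤ length arrows
      extensions-bound = subst (_≤ length arrows) (length-⊕ vertices branching)
        (length-≤ R (⊕-unique vertices-unique (Uniqueₚ.filter⁺ (withLength? special?) vertices-unique)) total injective)
        where
        branching = filter (withLength? special?) vertices

        R : Word k ⊎ Word k → Word k → Set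
        R (inj₁ w) e = ∃[ a ] e ≡ w ▷ a × Least (λ b → 𝓛 u (w ▷ b)) a
        R (inj₂ w) e = ∃[ a ] e ≡ w ▷ a × NonLeast (λ b → 𝓛 u (w ▷ b)) a

        total : ∀ {x} → x ∈ vertices ⊕ branching → ∃[ e ] e ∈ arrows × R x e
        total x∈ with ∈-⊕⁻ vertices x∈
        ... | inj₁ (w , w∈ , refl) with Equivalence.to (vertices-spec w) w∈
        ...   | occ , len with least {P = λ b → 𝓛 u (w ▷ b)} (λ b → arrow? (w ▷ b) (▷-length w len)) (proj₂ (extensible (occ , len)))
        ...     | a , l = w ▷ a , ∈-arrows (proj₁ l) (▷-length w len) , a , refl , l
        total x∈ | inj₂ (w , w∈ , refl) with ∈-filter⁻ (withLength? special?) {xs = vertices} w∈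
        ... | _ , len , a , b , a≢b , wa , wb with nonLeast {P = λ b → 𝓛 u (w ▷ b)} a≢b wa wb
        ...   | c , l = w ▷ c , ∈-arrows (proj₁ l) (▷-length w len) , c , refl , l

        injective : ∀ {x x′ e} → R x e → R x′ e → x ≡ x′
        injective {inj₁ w} {inj₁ w′} (_ , e , _) (_ , e′ , _) = cong inj₁ (proj₁ (▷-injective w w′ (trans (sym e) e′)))
        injective {inj₂ w} {inj₂ w′} (_ , e , _) (_ , e′ , _) = cong inj₂ (proj₁ (▷-injective w w′ (trans (sym e) e′)))
        injective {inj₁ w} {inj₂ w′} (_ , e , l) (_ , e′ , l′) with ▷-injective w w′ (trans (sym e) e′)
        ... | refl , refl = ⊥-elim (¬Least×NonLeast l l′)
        injective {inj₂ w} {inj₁ w′} (_ , e , l′) (_ , e′ , l) with ▷-injective w w′ (trans (sym e) e′)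
        ... | refl , refl = ⊥-elim (¬Least×NonLeast l l′)

    rightSpecials leftSpecials : List (Word k)
    rightSpecials = filter (withLength? RightSpecial?) vertices
    leftSpecials  = filter (withLength? LeftSpecial?) vertices

    rightSpecials-bound : length vertices + length rightSpecials ≤ length arrows
    rightSpecials-bound = extensions-bound (λ w a → w ++ [ a ])
      (λ w w′ eq → ∷ʳ-injective w w′ eq) length-snoc extend RightSpecial?
      where
      extend : ∀ {w} → 𝓛ₙ u n w → ∃[ a ] 𝓛 u (w ++ [ a ])
      extend ((i , occ) , len) = u (i + n) , subst (𝓛 u)
        (trans (factor-snoc u i n) (cong (_++ [ u (i + n) ]) (trans (cong (fac i) (sym len)) occ))) (factor∈𝓛 u i (suc n))

    leftSpecials-bound : length vertices + length leftSpecials ≤ length arrows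
    leftSpecials-bound = extensions-bound (λ w a → a ∷ w)
      (λ w w′ eq → ∷-injectiveʳ eq , ∷-injectiveˡ eq) (λ w → cong suc) extend LeftSpecial?
      where
      extend : ∀ {w} → 𝓛ₙ u n w → ∃[ a ] 𝓛 u (a ∷ w)
      -- An occurrence at position 0 has no letter before it; recurrence supplies a later one.
      extend (w∈ , len) with recurs-after w∈ 1
      ... | suc i , _ , occ = u i , subst (𝓛 u)
        (trans (factor-cons u i n) (cong (u i ∷_) (trans (cong (fac (suc i)) (sym len)) occ))) (factor∈𝓛 u i (suc n))

    -- Inclusion and exclusion: a special factor takes its entry among the right special ones if it
    -- has one, which leaves the left entry of a bispecial factor free for its second listing.
    specials-bound : (bispecials : List (Word k)) → Unique bispecials →
      (∀ {w} → w ∈ bispecials → BispecialOfLength u n w) →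
      length specials + length bispecials ≤ length rightSpecials + length leftSpecials
    specials-bound bispecials bispecials-unique ∈-bispecials = subst₂ _≤_
      (length-⊕ specials bispecials) (length-⊕ rightSpecials leftSpecials)
      (length-≤ R (⊕-unique (Uniqueₚ.filter⁺ (withLength? Special?) vertices-unique) bispecials-unique) total injective)
      where
      R : Word k ⊎ Word k → Word k ⊎ Word k → Set
      R (inj₁ v) (inj₁ w) = v ≡ w
      R (inj₁ v) (inj₂ w) = v ≡ w × ¬ RightSpecial u w
      R (inj₂ v) (inj₁ w) = ⊥
      R (inj₂ v) (inj₂ w) = v ≡ w × RightSpecial u w

      ∈-right : ∀ {w} → 𝓛 u w → length w ≡ n → RightSpecial u w → w ∈ rightSpecials
      ∈-right occ len sp = ∈-filter⁺ (withLength? RightSpecial?) (∈-vertices occ len) (len , sp)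

      ∈-left : ∀ {w} → 𝓛 u w → length w ≡ n → LeftSpecial u w → w ∈ leftSpecials
      ∈-left occ len sp = ∈-filter⁺ (withLength? LeftSpecial?) (∈-vertices occ len) (len , sp)

      total : ∀ {x} → x ∈ specials ⊕ bispecials → ∃[ y ] y ∈ rightSpecials ⊕ leftSpecials × R x y
      total x∈ with ∈-⊕⁻ specials x∈
      ... | inj₂ (w , w∈ , refl) with ∈-bispecials w∈
      ...   | (occ , len) , left , right = inj₂ w , ∈-⊕ʳ rightSpecials (∈-left occ len left) , refl , right
      total x∈ | inj₁ (w , w∈ , refl) with ∈-specials⁻ w∈
      ... | occ , len , sp with RightSpecial? w len | sp
      ...   | yes right | _          = inj₁ w , ∈-⊕ˡ (∈-right occ len right) , refl
      ...   | no ¬right | inj₁ left  = inj₂ w , ∈-⊕ʳ rightSpecials (∈-left occ len left) , refl , ¬right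
      ...   | no ¬right | inj₂ right = ⊥-elim (¬right right)

      injective : ∀ {x x′ y} → R x y → R x′ y → x ≡ x′
      injective {inj₁ _} {inj₁ _} {inj₁ _} p q = cong inj₁ (trans p (sym q))
      injective {inj₁ _} {inj₁ _} {inj₂ _} (p , _) (q , _) = cong inj₁ (trans p (sym q))
      injective {inj₁ _} {inj₂ _} {inj₂ _} (_ , ¬right) (_ , right) = ⊥-elim (¬right right)
      injective {inj₂ _} {inj₁ _} {inj₂ _} (_ , right) (_ , ¬right) = ⊥-elim (¬right right)
      injective {inj₂ _} {inj₂ _} {inj₂ _} (p , _) (q , _) = cong inj₂ (trans p (sym q))

    -- The sum of the seven inequalities collected below. `edges-bound` enters twice because the
    -- number of edges appears on the larger side both for the frequencies and for the spanning
    -- tree. The terms common to both sides are gathered in `rest` and cancelled.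
    frequencies-≤ : ∀ {m} (ρ : Fin m → ℝ) → (∀ i j → i ≢ j → ¬ ρ i ≃ ρ j) →
      (∀ i → ∃[ e ] 𝓛ₙ u (suc n) e × HasFrequency u e (ρ i)) →
      (bispecials : List (Word k)) → Unique bispecials → (∀ {w} → w ∈ bispecials → BispecialOfLength u n w) →
      (palindromes : List (Word k)) → Unique palindromes →
      (∀ {w} → w ∈ palindromes → BispecialOfLength u n w × GPalindrome G w) →
      order * m + length bispecials + length palindromes + 4 * length vertices ≤ 4 * length arrows + order
    frequencies-≤ {m} ρ ρ-distinct ρ-frequency bispecials bispecials-unique ∈-bispecials palindromes palindromes-unique ∈-palindromes =
      +-cancelʳ-≤ rest _ _ (subst₂ _≤_ 
        (left (order * m) (length specials) (length palindromes) (length palindromicEdges) (length edges)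
          (length vertices) (length rightSpecials) (length leftSpecials) (length bispecials))
        (right (length edges) (length palindromicEdges) order (length arrows) (length specials)
          (length rightSpecials) (length leftSpecials))
        (+-mono-≤ (frequencies-bound ρ ρ-distinct ρ-frequency)
        (+-mono-≤ (palindromes-bound palindromes palindromes-unique special-palindrome)
        (+-mono-≤ edges-bound
        (+-mono-≤ edges-bound
        (+-mono-≤ rightSpecials-bound
        (+-mono-≤ leftSpecials-bound
          (specials-bound bispecials bispecials-unique ∈-bispecials))))))))
      where
      open import Data.Nat.Tactic.RingSolver using (solve-∀)
      rest = length palindromicEdges + 2 * length edges + 2 * length specials + length rightSpecials + length leftSpecials

      special-palindrome : ∀ {w} → w ∈ palindromes → 𝓛 u w × length w ≡ n × Special u w × GPalindrome G w
      special-palindrome w∈ with ∈-palindromes w∈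
      ... | ((occ , len) , left , _) , pal = occ , len , inj₁ left , pal

      left : ∀ f V Y P E V′ R L X →
        f + (V + Y + P + (E + V′ + (E + V′ + (V′ + R + (V′ + L + (V + X)))))) ≡
        f + X + Y + 4 * V′ + (P + 2 * E + 2 * V + R + L)
      left = solve-∀

      right : ∀ E P o A V R L →
        E + P + (o + E + (A + V + (A + V + (A + (A + (R + L)))))) ≡
        4 * A + o + (P + 2 * E + 2 * V + R + L)
      right = solve-∀

-- Long factors contain all letters

module LetterWindows where
  open import Data.Nat using (ℕ; zero; suc; _+_; _≤_; _<_; s≤s)
  open import Data.Nat.Properties
  open import Data.Fin using (Fin; zero; suc)
  open import Data.List using (_∷_; [_]; _++_)
  open import Data.List.Properties using (∷-injectiveˡ)
  open import Data.Product using (∃-syntax; _×_; _,_; proj₁; proj₂)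
  open import Function using (_∘_)
  open import Relation.Binary.PropositionalEquality hiding ([_])
  open Words

  module Letters {k : ℕ} (u : InfWord k) (recurrent : UniformlyRecurrent u) where

    letter-window : ∀ a → ∃[ i ] u i ≡ a → ∃[ B ] (∀ i → ∃[ d ] d < B × u (i + d) ≡ a)
    -- The waiting time is at most `i₀` at the start of `u`. It then decreases as the position
    -- advances, and after each occurrence it is renewed by a gap of at most `R`.
    letter-window a (i₀ , eq₀) = suc (i₀ + R) , window
      where
      occurs : ∀ {j} → u j ≡ a → OccursAt u [ a ] j
      occurs {j} eq = cong [_] (trans (cong u (+-identityʳ j)) eq)

      occurs⁻ : ∀ {j} → OccursAt u [ a ] j → u j ≡ a
      occurs⁻ {j} occ = trans (cong u (sym (+-identityʳ j))) (∷-injectiveˡ occ)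

      gaps = recurrent [ a ] (i₀ , occurs eq₀)
      R = proj₁ gaps

      window : ∀ i → ∃[ d ] d < suc (i₀ + R) × u (i + d) ≡ a
      window zero = i₀ , s≤s (m≤m+n i₀ R) , eq₀
      window (suc i) with window i
      ... | suc d , d< , eq = d , <⇒≤ d< , trans (cong u (sym (+-suc i d))) eq
      ... | zero , _ , eq with proj₂ gaps i (occurs (trans (cong u (sym (+-identityʳ i))) eq))
      ...   | j , i<j , j≤ , occ with m≤n⇒∃[o]m+o≡n i<j
      ...     | d , refl = d , <⇒≤ (s≤s (≤-trans (+-cancelˡ-≤ i (suc d) R (subst (_≤ i + R) (sym (+-suc i d)) j≤)) (m≤n+m R i₀))) , occurs⁻ occ

    upper-bound : ∀ {m} (f : Fin m → ℕ) → ∃[ N ] (∀ a → f a ≤ N)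
    upper-bound {zero}  f = 0 , λ ()
    upper-bound {suc m} f with upper-bound (f ∘ suc)
    ... | N , bound = f zero + N , λ { zero → m≤m+n (f zero) N ; (suc a) → ≤-trans (bound a) (m≤n+m N (f zero)) }

    long-factors-AllLetters : (∀ a → ∃[ i ] u i ≡ a) → ∃[ N ] (∀ n → N ≤ n → ∀ i → AllLetters (factor u i n))
    long-factors-AllLetters occur = N , contains
      where
      windows = λ a → letter-window a (occur a)
      bounds = upper-bound (λ a → proj₁ (windows a))
      N = proj₁ bounds

      contains : ∀ n → N ≤ n → ∀ i → AllLetters (factor u i n)
      contains n N≤n i a with proj₂ (windows a) i
      ... | d , d< , eq with m≤n⇒∃[o]m+o≡n (≤-trans d< (≤-trans (proj₂ bounds a) N≤n))
      ...   | r , refl = factor u i d , factor u (i + d + 1) r , (begin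
        factor u i (suc d + r)                                       ≡⟨ cong (factor u i) (+-suc d r) ⟨
        factor u i (d + (1 + r))                                     ≡⟨ factor-split₃ u i d 1 r ⟩
        factor u i d ++ factor u (i + d) 1 ++ factor u (i + d + 1) r ≡⟨ cong (λ b → factor u i d ++ b ∷ factor u (i + d + 1) r) (trans (cong u (+-identityʳ (i + d))) eq) ⟩
        factor u i d ++ [ a ] ++ factor u (i + d + 1) r              ∎)
        where open ≡-Reasoning

-- The bound on the number of frequencies

open import Data.Nat using (ℕ; suc)
import Data.Nat as ℕ
open import Data.Integer using (+_; _+_; _-_; _*_)
open import Data.Rational using (_/_; _≤_)
open import Data.Fin using (Fin)
open import Data.Product using (∃-syntax; _×_; _,_; proj₁; proj₂)
open import Data.List using (length; lookup)
import Data.List.Membership.Setoid.Properties as Membershipₚ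
open import Function using (Equivalence)
open import Relation.Binary.PropositionalEquality using (_≡_; refl)
open Counting using (lookup-pairwise)
open Frequency using (HasFrequency; hasFrequency; ≤-from-cross-multiplied)
open RauzyGraph using (module FixedLength)
open LetterWindows using (module Letters)

theorem18 : ∀ (k : ℕ) (G : FiniteSubgroupAM k) (u : InfWord k) → let open FiniteSubgroupAM G in
    (∃[ i ] Antimorphism (elem i)) →
    -- 𝒜 = Fin k is the alphabet of u: every letter occurs in u
    (∀ (a : Fin k) → ∃[ i ] u i ≡ a) →
    UniformlyRecurrent u →
    Aperiodic u →
    InvariantUnder u G →
    (∀ w → 𝓛 u w → ∃[ ρ ] IsFrequency u w ρ) →
    ∃[ N ] (∀ n → N ℕ.≤ n →
      ∀ (#freq C[n] C[n+1] X Y : ℕ) →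
      HasCard ℝ-setoid (Frequencies u (suc n)) #freq →
      HasCard (Word-setoid k) (𝓛ₙ u n) C[n] →
      HasCard (Word-setoid k) (𝓛ₙ u (suc n)) C[n+1] →
      HasCard (Word-setoid k) (BispecialOfLength u n) X →
      HasCard (Word-setoid k) (λ w → BispecialOfLength u n w × GPalindrome G w) Y →
      + #freq / 1 ≤ (+ 4 * (+ C[n+1] - + C[n]) + + order - + X - + Y) / order)
theorem18 k G u (θ , θ-anti) occur recurrent aperiodic invariant _ = N , bound
  where
  open FiniteSubgroupAM G
  N = proj₁ (Letters.long-factors-AllLetters u recurrent occur)

  bound : ∀ n → N ℕ.≤ n → ∀ (#freq C[n] C[n+1] X Y : ℕ) →
    HasCard ℝ-setoid (Frequencies u (suc n)) #freq →
    HasCard (Word-setoid k) (𝓛ₙ u n) C[n] →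
    HasCard (Word-setoid k) (𝓛ₙ u (suc n)) C[n+1] →
    HasCard (Word-setoid k) (BispecialOfLength u n) X →
    HasCard (Word-setoid k) (λ w → BispecialOfLength u n w × GPalindrome G w) Y →
    + #freq / 1 ≤ (+ 4 * (+ C[n+1] - + C[n]) + + order - + X - + Y) / order
  -- Matching the length equations with `refl` replaces all cardinalities by lengths of the
  -- witnessing lists, the form in which the counting inequality is stated.
  bound n N≤n _ _ _ _ _ (ρs , ρs-unique , refl , ρs-spec) (vs , vs-unique , refl , vs-spec)
    (as , as-unique , refl , as-spec) (bs , bs-unique , refl , bs-spec) (ps , ps-unique , refl , ps-spec) =
    ≤-from-cross-multiplied (length ρs) order (length bs) (length ps) (length vs) (length as)
      (frequencies-≤ (lookup ρs) (lookup-pairwise (λ {x} {y} x≄y y≃x → x≄y (≃-sym {y} {x} y≃x)) ρs-unique) frequency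
        bs bs-unique (Equivalence.to (bs-spec _)) ps ps-unique (Equivalence.to (ps-spec _)))
    where
    open FixedLength G u recurrent aperiodic invariant θ θ-anti n
      (proj₂ (Letters.long-factors-AllLetters u recurrent occur) n N≤n) vs vs-unique vs-spec as as-unique as-spec
      using (frequencies-≤)

    frequency : ∀ i → ∃[ e ] 𝓛ₙ u (suc n) e × HasFrequency u e (lookup ρs i)
    frequency i with Equivalence.to (ρs-spec (lookup ρs i)) (Membershipₚ.∈-lookup ℝ-setoid ρs i)
    ... | e , e∈ , freq = e , e∈ , hasFrequency freq
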